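{- Given a regular code $X\subseteq A^*$, for every integer $k\ge 1$ and every automorphism or anti-automorphism $\theta$ of $A^*$, it can be decided whether $X$ satisfies any of the conditions (c1), (c2), (c3), (c4) (each taken individually, as defined in the context) with respect to each of the relations $\mathcal{P}_k$, $\mathcal{F}_k$, and $\widehat{\theta}$.
   Context: $A$ is a finite alphabet with $|A|\ge 2$; $A^*$ is the free monoid over $A$, with empty word $\varepsilon$, and $|w|$ is the length of $w$. A subset of $A^*$ is regular if it is recognized by a finite automaton; in decidability statements a regular set is given by a finite automaton. A set $X\subseteq A^*$ is a code if for all words $x_1,\dots,x_n,y_1,\dots,y_p\in X$, $x_1\cdots x_n=y_1\cdots y_p$ implies $n=p$ and $x_i=y_i$ for every $i$. For a binary relation $\tau\subseteq A^*\times A^*$ and $X\subseteq A^*$, $\tau(X)=\{y:\exists x\in X,\ (x,y)\in\tau\}$ and $\tau(x)=\tau(\{x\})$; $\widehat{\tau}=\tau\cup\{(w,w):w\in A^*\}$ is the reflexive closure of $\tau$ and $\underline{\tau}=\tau\setminus\{(w,w):w\in A^*\}$ its anti-reflexive restriction. $X$ is $\tau$-independent if $\tau(X)\cap X=\emptyset$. The relations: $(w,w')\in\mathcal{P}_k$ iff $|w|+|w'|-2|w\wedge w'|\le k$, where $w\wedge w'$ is the longest common prefix of $w,w'$; $(w,w')\in\mathcal{F}_k$ iff $|w|+|w'|-2|f|\le k$, where $f$ is a maximum length common factor (contiguous subword) of $w,w'$. An anti-automorphism of $A^*$ is a bijection $\theta:A^*\to A^*$ with $\theta(uv)=\theta(v)\theta(u)$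 for all $u,v$; an automorphism is a monoid automorphism; such a $\theta$ is identified with its graph $\{(w,\theta(w)):w\in A^*\}$, so $\widehat{\theta}=\theta\cup\{(w,w):w\in A^*\}$. Conditions on a code $X$ with respect to a reflexive relation $\tau$: (c1) $X$ is $\underline{\tau}$-independent. (c2) For all $x,y\in X$, $\tau(x)\cap\tau(y)\neq\emptyset$ implies $x=y$. (c3) $X$ is maximal (for inclusion) in the family of $\underline{\tau}$-independent codes (in particular $X$ belongs to this family). (c4) $\widehat{\tau}(X)$ is a code. -}

module Defs where

open import Algebra.Morphism.Structures using (module MonoidMorphisms)
open import Data.Fin.Base using (Fin)
open import Data.Fin.Subset using (Subset) renaming (_∈_ to _∈ˢ_)
open import Data.List.Base using (List; []; _∷_; _++_; length; concat; ++-[]-rawMonoid)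
open import Data.List.Relation.Binary.Infix.Heterogeneous using (Infix)
open import Data.List.Relation.Binary.Prefix.Heterogeneous using (Prefix)
open import Data.List.Relation.Unary.All using (All)
open import Data.Nat.Base using (ℕ; _+_; _*_; _∸_; _≤_)
open import Data.Product.Base using (∃-syntax; _×_)
open import Function.Definitions using (Bijective)
open import Level using (0ℓ; suc)
open import Relation.Binary.Construct.Closure.Reflexive using (ReflClosure)
open import Relation.Binary.Core using (Rel)
open import Relation.Binary.PropositionalEquality.Core using (_≡_; _≢_)
open import Relation.Nullary.Decidable.Core using (Dec)
open import Relation.Unary using (Pred; _∈_; _⊆_; _∩_; _≬_; ｛_｝; Empty)

Word : Set → Set
Word A = List A

Lang : Set → Set₁
Lang A = Pred (Word A) 0ℓ

WordRel : Set → Set₁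
WordRel A = Rel (Word A) 0ℓ

-- Nondeterministic, without ε-transitions.
record Automaton (A : Set) : Set where
  field
    states  : ℕ
    initial : Subset states
    final   : Subset states
    step    : Fin states → A → Subset states

module _ {A : Set} where

  module _ (M : Automaton A) where
    open Automaton M

    AcceptedFrom : Fin states → Lang A
    AcceptedFrom q []      = q ∈ˢ final
    AcceptedFrom q (a ∷ w) = ∃[ r ] r ∈ˢ step q a × AcceptedFrom r w

    Recognized : Lang A
    Recognized w = ∃[ q ] q ∈ˢ initial × AcceptedFrom q w

  -- Empty factorizations are allowed. This changes nothing: they only add the
  -- requirement that [] ∉ X, which already follows from [] ++ [] ≡ [].
  IsCode : Pred (Lang A) 0ℓ
  IsCode X = ∀ (xs ys : List (Word A)) → All X xs → All X ys →
             concat xs ≡ concat ys → xs ≡ ys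

  image : WordRel A → Lang A → Lang A
  image τ X y = ∃[ x ] x ∈ X × τ x y

  antiReflexive : WordRel A → WordRel A
  antiReflexive τ x y = τ x y × x ≢ y

  Independent : WordRel A → Pred (Lang A) 0ℓ
  Independent τ X = Empty (image τ X ∩ X)

  IsLongest : Pred (Word A) 0ℓ → Pred (Word A) 0ℓ
  IsLongest P w = P w × (∀ v → P v → length v ≤ length w)

  CommonPrefix : Word A → Word A → Pred (Word A) 0ℓ
  CommonPrefix w w′ p = Prefix _≡_ p w × Prefix _≡_ p w′

  CommonFactor : Word A → Word A → Pred (Word A) 0ℓ
  CommonFactor w w′ f = Infix _≡_ f w × Infix _≡_ f w′

  -- In 𝒫 and ℱ the subtraction _∸_ never truncates, since a common prefix or
  -- factor is no longer than either word.
  𝒫 : ℕ → WordRel A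
  𝒫 k w w′ = ∃[ p ] IsLongest (CommonPrefix w w′) p ×
                    length w + length w′ ∸ 2 * length p ≤ k

  ℱ : ℕ → WordRel A
  ℱ k w w′ = ∃[ f ] IsLongest (CommonFactor w w′) f ×
                    length w + length w′ ∸ 2 * length f ≤ k

  IsAutomorphism : (Word A → Word A) → Set
  IsAutomorphism = MonoidMorphisms.IsMonoidIsomorphism M M
    where M = ++-[]-rawMonoid A

  IsAntiAutomorphism : (Word A → Word A) → Set
  IsAntiAutomorphism θ =
    Bijective _≡_ _≡_ θ × (∀ u v → θ (u ++ v) ≡ θ v ++ θ u)

  graph : (Word A → Word A) → WordRel A
  graph θ w w′ = θ w ≡ w′

  module _ (τ : WordRel A) where

    IndependentCode : Pred (Lang A) 0ℓ
    IndependentCode X = IsCode X × Independent (antiReflexive τ) X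

    C1 : Pred (Lang A) 0ℓ
    C1 X = Independent (antiReflexive τ) X

    C2 : Pred (Lang A) 0ℓ
    C2 X = ∀ {x y} → x ∈ X → y ∈ X → image τ ｛ x ｝ ≬ image τ ｛ y ｝ → x ≡ y

    -- Maximality ranges over arbitrary languages, regular or not.
    C3 : Pred (Lang A) (suc 0ℓ)
    C3 X = IndependentCode X ×
           (∀ (Y : Lang A) → IndependentCode Y → X ⊆ Y → Y ⊆ X)

    C4 : Pred (Lang A) 0ℓ
    C4 X = IsCode (image (ReflClosure τ) X)

    EachDecidable : Pred (Lang A) (suc 0ℓ)
    EachDecidable X = Dec (C1 X) × Dec (C2 X) × Dec (C3 X) × Dec (C4 X)

{-# OPTIONS --safe #-}

-- A regular language is a union of classes of a two-sided congruence of finite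
-- index.  By the pigeonhole principle each class has a short representative, so
-- quantifiers over words are decidable for predicates saturated by such a
-- congruence; this decides codes, (c1), (c2), (c4) and completeness.
--
-- The distances behind 𝒫 and ℱ are metrics in which midpoints exist, so (c2) for
-- k is (c1) for 2k.  The words moved by an anti-automorphism do not form a regular
-- set; they are found by reading a word from both ends at once, over A × A.
--
-- (c3) means (c1) together with completeness.  If X is complete, take x ∈ X* in the
-- minimal ideal of the syntactic monoid of X*: for each y there is n ≥ 1 such that
-- (xyx)ⁿx is equivalent to x, hence lies in X*, and a code containing X and y then
-- has y ∈ X.  If some word is not a factor of X*, an unbordered word surrounding it
-- with long padding can be added to X.
module Submission where

open import Defs
open import Algebra.Morphism.Structures using (module MonoidMorphisms)
open import Data.Empty using (⊥)
open import Data.Fin.Base as Fin using (Fin; zero; suc; toℕ; combine; funToFin; finToFun)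
open import Data.Fin.Properties as Fin using (pigeonhole; combine-injective; finToFun-funToFin; toℕ≤pred[n])
open import Data.Fin.Subset using () renaming (_∈_ to _∈ˢ_)
open import Data.Fin.Subset.Properties using (_∈?_)
open import Data.List.Base using (List; []; _∷_; _++_; [_]; length; concat; take; drop; replicate; tabulate; map; initLast; _∷ʳ′_)
open import Data.List.Membership.Propositional.Properties using (∈-∃++; ∈-tabulate⁺)
open import Data.List.Properties using (++-assoc; ++-identityʳ; ++-cancelˡ; ++-monoid; length-++; ∷-injective; length-take; length-drop; take++drop≡id; length-++-≤ʳ; length-++-≤ˡ; ++-conicalˡ; ++-conicalʳ; concat-++; ≡-dec; ++-identityʳ-unique; ∷-injectiveˡ; ∷-injectiveʳ; length-replicate; map-++; length-++-comm)
open import Data.List.Relation.Binary.Infix.Heterogeneous as Infix using (Infix; MkView)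
open import Data.List.Relation.Binary.Infix.Heterogeneous.Properties using (infix?)
open import Data.List.Relation.Binary.Pointwise using (Pointwise-≡⇒≡; ≡⇒Pointwise-≡)
open import Data.List.Relation.Binary.Prefix.Heterogeneous as Prefix using (Prefix)
open import Data.List.Relation.Binary.Prefix.Heterogeneous.Properties using (prefix?)
open import Data.List.Relation.Unary.All as All using (All; []; _∷_)
open import Data.List.Relation.Unary.All.Properties using (++⁺; ++⁻ʳ; replicate⁺)
open import Data.Nat.Base using (ℕ; zero; suc; _+_; _∸_; _*_; _≤_; _<_; z≤n; s≤s; s≤s⁻¹; _^_)
open import Data.Nat.Properties as ℕ using (≤-refl; ≤-trans; ≤-reflexive; n<1+n; m≤m+n; m≤n+m; _≤?_; ≰⇒>; m≤n⇒m⊓n≡m; module ≤-Reasoning; +-monoˡ-<; m+[n∸m]≡n; <⇒≤; +-comm; +-suc; <⇒≢; m<m+n; +-cancelˡ-≤; +-identityʳ; m+n≤o⇒m≤o; m+n≤o⇒n≤o; +-mono-≤; ≤∧≢⇒<; m+n∸m≡n; m∸[m∸n]≡n; ∸-monoʳ-≤; *-monoʳ-≤; m≤n⇒∃[o]m+o≡n; <⇒≱; m≤n⇒m≤1+n; ≤-antisym; suc-injective)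
open import Data.Nat.Tactic.RingSolver using (solve-∀)
open import Data.Product.Base using (∃; ∃₂; _×_; _,_; proj₁; proj₂)
open import Data.Sum.Base using (_⊎_; inj₁; inj₂)
open import Data.Unit.Base using (⊤)
open import Function.Base using (_∘_; id)
open import Function.Bundles using (_↔_; Inverse)
open import Function.Definitions using (Bijective; Injective)
open import Relation.Binary.Construct.Closure.Reflexive using (ReflClosure; refl) renaming ([_] to related)
open import Relation.Binary.Definitions using (_Respects_; DecidableEquality)
open import Relation.Binary.PropositionalEquality using (_≡_; _≢_; refl; sym; trans; cong; cong₂; subst; module ≡-Reasoning; subst₂)
open import Relation.Nullary using (Dec; yes; no; ¬_; contradiction)
open import Relation.Nullary.Decidable using (map′; _×-dec_; _⊎-dec_; ¬?; decidable-stable)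
open import Relation.Unary using (Decidable)
open import Tactic.MonoidSolver using (solve)

-- Congruences are preferred to automata because the operations used here act on both sides of a
-- word: quotients by `u` and `v`, reversal under an anti-automorphism, quantification over a word
-- in the middle. Two obstacles shape the rest. Words close for 𝒫 or ℱ have the form u f v and u′ f
-- v′ with short margins, but (c1) only forbids distinct ones, so each f with u f v = u′ f v′ must
-- be discarded; these f form a regular set because the equation reduces to the conjugacy equation r
-- f = f s. In (c3) the rival language Y is arbitrary and membership in it cannot be tested.
-- Maximality therefore has to come from a single equality between two factorizations over Y, and
-- its failure has to be shown by an explicit larger code, which must moreover be independent. This
-- last demand is the reason for the padding: a word of X related to the new word would be forced to
-- contain a word that is not a factor of X*.

private variable
  A B : Set

-- Search through finite types, splittings and words of bounded length

Searchable : Set → Set₁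
Searchable A = ∀ {P : A → Set} → Decidable P → Dec (∃ P)

×-searchable : Searchable A → Searchable B → Searchable (A × B)
×-searchable s t P? =
  map′ (λ (a , b , p) → (a , b) , p) (λ ((a , b) , p) → a , b , p)
       (s λ a → t λ b → P? (a , b))

↔Fin-searchable : ∀ {n} → A ↔ Fin n → Searchable A
↔Fin-searchable A↔Fin {P} P? =
  map′ (λ (i , p) → from i , p)
       (λ (a , p) → to a , subst P (sym (strictlyInverseʳ a)) p)
       (Fin.any? (P? ∘ from))
  where open Inverse A↔Fin

-- Levi's lemma; `r` is the gap between the two cuts. When the cuts coincide the second alternative
-- is returned, with `r` empty.
++-split : ∀ (u s : Word A) {v t} → u ++ v ≡ s ++ t →
           (∃ λ r → u ≡ s ++ r × t ≡ r ++ v) ⊎ (∃ λ r → s ≡ u ++ r × v ≡ r ++ t)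
++-split []      s       e = inj₂ (s , refl , e)
++-split (a ∷ u) []      e = inj₁ (a ∷ u , refl , sym e)
++-split (a ∷ u) (b ∷ s) e with ∷-injective e
... | refl , e′ with ++-split u s e′
...   | inj₁ (r , p , q) = inj₁ (r , cong (a ∷_) p , q)
...   | inj₂ (r , p , q) = inj₂ (r , cong (a ∷_) p , q)

anySplit? : {Q : Word A → Word A → Set} → (∀ s t → Dec (Q s t)) →
            ∀ w → Dec (∃₂ λ s t → w ≡ s ++ t × Q s t)
anySplit? Q? [] = map′ (λ q → [] , [] , refl , q) (λ { ([] , [] , refl , q) → q }) (Q? [] [])
anySplit? {Q = Q} Q? (a ∷ w) =
  map′ (λ { (inj₁ q) → [] , a ∷ w , refl , q
          ; (inj₂ (s , t , refl , q)) → a ∷ s , t , refl , q })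
       (λ { ([] , _ , refl , q) → inj₁ q
          ; (_ ∷ s , t , refl , q) → inj₂ (s , t , refl , q) })
       (Q? [] (a ∷ w) ⊎-dec anySplit? (λ s t → Q? (a ∷ s) t) w)

anyUpTo? : Searchable A → ∀ N {P : Word A → Set} → Decidable P →
           Dec (∃ λ w → length w ≤ N × P w)
anyUpTo? any zero P? =
  map′ (λ p → [] , z≤n , p) (λ { ([] , _ , p) → p }) (P? [])
anyUpTo? any (suc N) P? =
  map′ (λ { (inj₁ p) → [] , z≤n , p
          ; (inj₂ (a , w , l , p)) → a ∷ w , s≤s l , p })
       (λ { ([] , _ , p) → inj₁ p
          ; (a ∷ w , s≤s l , p) → inj₂ (a , w , l , p) })
       (P? [] ⊎-dec any λ a → anyUpTo? any N (λ w → P? (a ∷ w)))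

-- Finite congruences and regular languages

-- Only the class map is recorded, and it may miss values of `Fin size`. Products and truth tables
-- can thus serve as classes without computing which of them occur.
record Congruence (A : Set) : Set where
  field
    size         : ℕ
    class        : Word A → Fin size
    ++-congruent : ∀ {u u′ v v′} → class u ≡ class u′ → class v ≡ class v′ →
                   class (u ++ v) ≡ class (u′ ++ v′)

  infix 4 _≈_
  _≈_ : Word A → Word A → Set
  u ≈ v = class u ≡ class v

  ++-congˡ : ∀ u {v v′} → v ≈ v′ → (u ++ v) ≈ (u ++ v′)
  ++-congˡ u = ++-congruent {u} {u} refl

  ++-congʳ : ∀ v {u u′} → u ≈ u′ → (u ++ v) ≈ (u′ ++ v)
  ++-congʳ v p = ++-congruent {v = v} {v} p refl

  factor-cong : ∀ u v {f f′} → f ≈ f′ → (u ++ f ++ v) ≈ (u ++ f′ ++ v)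
  factor-cong u v p = ++-congˡ u (++-congʳ v p)

  -- Pumping downwards: among the `size + 1` prefixes of length at most `size` two are equivalent,
  -- and the stretch between their ends can be cut out.
  shorten : ∀ w → size ≤ length w → ∃ λ w′ → length w′ < length w × w ≈ w′
  shorten w l with pigeonhole (n<1+n size) (λ i → class (take (toℕ i) w))
  ... | i , j , i<j , e = take (toℕ i) w ++ drop (toℕ j) w , shorter , equiv
    where
    j≤ : toℕ j ≤ length w
    j≤ = ≤-trans (toℕ≤pred[n] j) l
    length-take-i : length (take (toℕ i) w) ≡ toℕ i
    length-take-i = trans (length-take (toℕ i) w) (m≤n⇒m⊓n≡m (≤-trans (<⇒≤ i<j) j≤))
    shorter : length (take (toℕ i) w ++ drop (toℕ j) w) < length w
    shorter = begin-strict
      length (take (toℕ i) w ++ drop (toℕ j) w)          ≡⟨ length-++ (take (toℕ i) w) ⟩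
      length (take (toℕ i) w) + length (drop (toℕ j) w)  ≡⟨ cong₂ _+_ length-take-i (length-drop (toℕ j) w) ⟩
      toℕ i + (length w ∸ toℕ j)                         <⟨ +-monoˡ-< (length w ∸ toℕ j) i<j ⟩
      toℕ j + (length w ∸ toℕ j)                         ≡⟨ m+[n∸m]≡n j≤ ⟩
      length w                                           ∎
      where open ≤-Reasoning
    equiv : w ≈ (take (toℕ i) w ++ drop (toℕ j) w)
    equiv = trans (cong class (sym (take++drop≡id (toℕ j) w))) (++-congʳ (drop (toℕ j) w) (sym e))

  representative : ∀ w → ∃ λ w′ → length w′ ≤ size × w ≈ w′
  representative w = go (length w) w ≤-refl
    where
    go : ∀ n w → length w ≤ n → ∃ λ w′ → length w′ ≤ size × w ≈ w′
    go n w l with length w ≤? size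
    ... | yes s = w , s , refl
    go zero w l | no ¬s = contradiction (≤-trans l z≤n) ¬s
    go (suc n) w l | no ¬s with shorten w (<⇒≤ (≰⇒> ¬s))
    ... | w₁ , l₁ , e₁ with go n w₁ (s≤s⁻¹ (≤-trans l₁ l))
    ... | w₂ , l₂ , e₂ = w₂ , l₂ , trans e₁ e₂

  anyWord? : Searchable A → ∀ {P : Word A → Set} → P Respects _≈_ → Decidable P → Dec (∃ P)
  anyWord? any resp P? =
    map′ (λ (w , _ , p) → w , p)
         (λ (w , p) → let w′ , l , e = representative w in w′ , l , resp e p)
         (anyUpTo? any size P?)

infixr 6 _⊗_
_⊗_ : Congruence A → Congruence A → Congruence A
C ⊗ D = record
  { size = C.size * D.size
  ; class = λ w → combine (C.class w) (D.class w)
  ; ++-congruent = λ {u} {u′} {v} {v′} p q →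
      let p₁ , p₂ = combine-injective (C.class u) (D.class u) (C.class u′) (D.class u′) p
          q₁ , q₂ = combine-injective (C.class v) (D.class v) (C.class v′) (D.class v′) q
      in cong₂ combine (C.++-congruent p₁ q₁) (D.++-congruent p₂ q₂)
  }
  where
  module C = Congruence C
  module D = Congruence D

module _ (C D : Congruence A) where
  private
    module C = Congruence C
    module D = Congruence D
    module C⊗D = Congruence (C ⊗ D)

  ⊗-split : ∀ u v → u C⊗D.≈ v → u C.≈ v × u D.≈ v
  ⊗-split u v = combine-injective (C.class u) (D.class u) (C.class v) (D.class v)

  ⊗-respectsˡ : {L : Lang A} → L Respects C._≈_ → L Respects C⊗D._≈_
  ⊗-respectsˡ r {u} {v} e = r (proj₁ (⊗-split u v e))

  ⊗-respectsʳ : {L : Lang A} → L Respects D._≈_ → L Respects C⊗D._≈_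
  ⊗-respectsʳ r {u} {v} e = r (proj₂ (⊗-split u v e))

trivial : Congruence A
trivial = record { size = 1 ; class = λ _ → zero ; ++-congruent = λ _ _ → refl }

decToFin : {P : Set} → Dec P → Fin 2
decToFin (no _)  = zero
decToFin (yes _) = suc zero

decToFin-cong : {P Q : Set} (P? : Dec P) (Q? : Dec Q) → (P → Q) → (Q → P) → decToFin P? ≡ decToFin Q?
decToFin-cong (yes _) (yes _) _ _ = refl
decToFin-cong (yes p) (no ¬q) f _ = contradiction (f p) ¬q
decToFin-cong (no ¬p) (yes q) _ g = contradiction (g q) ¬p
decToFin-cong (no _)  (no _)  _ _ = refl

decToFin-transport : {P Q : Set} (P? : Dec P) (Q? : Dec Q) → decToFin P? ≡ decToFin Q? → P → Q
decToFin-transport (yes _) (yes q) _ _ = q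
decToFin-transport (no ¬p) _       _ p = contradiction p ¬p

funToFin-cong : ∀ {m n} {f g : Fin m → Fin n} → (∀ i → f i ≡ g i) → funToFin f ≡ funToFin g
funToFin-cong {zero}  e = refl
funToFin-cong {suc m} e = cong₂ combine (e zero) (funToFin-cong (e ∘ suc))

funToFin-injective : ∀ {m n} {f g : Fin m → Fin n} → funToFin f ≡ funToFin g → ∀ i → f i ≡ g i
funToFin-injective {f = f} {g} e i =
  trans (sym (finToFun-funToFin f i)) (trans (cong (λ k → finToFun k i) e) (finToFun-funToFin g i))

-- A word is coded by its Boolean matrix of truth values of the `P i j`, hence the factor
-- `(2 ^ m) ^ m`. `P-++` asks for implications in one direction; using it both ways shows that equal
-- matrices yield equal matrices after concatenation.
module Refine
  (C : Congruence A) {m : ℕ} (P : Fin m → Fin m → Lang A) (P? : ∀ i j → Decidable (P i j))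
  (P-++ : ∀ {u u′ v v′} → Congruence._≈_ C u u′ → Congruence._≈_ C v v′ →
          (∀ i j → P i j u → P i j u′) → (∀ i j → P i j v → P i j v′) →
          ∀ i j → P i j (u ++ v) → P i j (u′ ++ v′))
  where

  private
    module C = Congruence C

    code : Word A → Fin ((2 ^ m) ^ m)
    code w = funToFin λ i → funToFin λ j → decToFin (P? i j w)

    code-cong : ∀ {u v} → (∀ i j → P i j u → P i j v) → (∀ i j → P i j v → P i j u) → code u ≡ code v
    code-cong {u} {v} f g = funToFin-cong λ i → funToFin-cong λ j → decToFin-cong (P? i j u) (P? i j v) (f i j) (g i j)

    code-transport : ∀ u v → code u ≡ code v → ∀ i j → P i j u → P i j v
    code-transport u v e i j =
      decToFin-transport (P? i j u) (P? i j v) (funToFin-injective (funToFin-injective e i) j)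

  refined : Congruence A
  refined = record
    { size = C.size * (2 ^ m) ^ m
    ; class = λ w → combine (C.class w) (code w)
    ; ++-congruent = λ {u} {u′} {v} {v′} p q →
        let p₁ , p₂ = combine-injective (C.class u) (code u) (C.class u′) (code u′) p
            q₁ , q₂ = combine-injective (C.class v) (code v) (C.class v′) (code v′) q
        in cong₂ combine (C.++-congruent p₁ q₁)
             (code-cong (P-++ p₁ q₁ (code-transport u u′ p₂) (code-transport v v′ q₂))
                        (P-++ (sym p₁) (sym q₁) (code-transport u′ u (sym p₂)) (code-transport v′ v (sym q₂))))
    }

  open Congruence refined using (_≈_)

  refined-respects : ∀ i j → P i j Respects _≈_
  refined-respects i j {u} {v} e =
    code-transport u v (proj₂ (combine-injective (C.class u) (code u) (C.class v) (code v) e)) i j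

-- Recognition by a finite monoid: the language is a decidable union of classes.
record Regular (L : Lang A) : Set where
  field
    congruence : Congruence A
  open Congruence congruence public
  field
    respects : L Respects _≈_
    member?  : Decidable L

open Regular using (congruence; respects; member?)

nonempty? : Searchable A → {L : Lang A} → Regular L → Dec (∃ L)
nonempty? any R = Regular.anyWord? R any (respects R) (member? R)

regular-ext : {L L′ : Lang A} → (∀ {w} → L w → L′ w) → (∀ {w} → L′ w → L w) → Regular L → Regular L′
regular-ext f g R = record
  { congruence = congruence R
  ; respects   = λ e → f ∘ respects R e ∘ g
  ; member?    = λ w → map′ f g (member? R w)
  }

regular-const : {P : Set} → Dec P → Regular {A} (λ _ → P)
regular-const P? = record { congruence = trivial ; respects = λ _ → id ; member? = λ _ → P? }

regular-∁ : {L : Lang A} → Regular L → Regular (λ w → ¬ L w)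
regular-∁ R = record
  { congruence = congruence R
  ; respects   = λ e ¬l → ¬l ∘ respects R (sym e)
  ; member?    = λ w → ¬? (member? R w)
  }

module _ {K L : Lang A} (R : Regular K) (S : Regular L) where

  private
    C = congruence R
    D = congruence S

  regular-∩ : Regular (λ w → K w × L w)
  regular-∩ = record
    { congruence = C ⊗ D
    ; respects   = λ { e (k , l) → ⊗-respectsˡ C D (respects R) e k , ⊗-respectsʳ C D (respects S) e l }
    ; member?    = λ w → member? R w ×-dec member? S w
    }

  regular-∪ : Regular (λ w → K w ⊎ L w)
  regular-∪ = record
    { congruence = C ⊗ D
    ; respects   = λ { e (inj₁ k) → inj₁ (⊗-respectsˡ C D (respects R) e k)
                     ; e (inj₂ l) → inj₂ (⊗-respectsʳ C D (respects S) e l) }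
    ; member?    = λ w → member? R w ⊎-dec member? S w
    }

regular-quotient : {L : Lang A} → Regular L → ∀ u v → Regular (λ f → L (u ++ f ++ v))
regular-quotient R u v = record
  { congruence = congruence R
  ; respects   = λ e → respects R (Regular.factor-cong R u v e)
  ; member?    = λ f → member? R (u ++ f ++ v)
  }

regular-⋃Fin : ∀ {n} {L : Fin n → Lang A} → (∀ i → Regular (L i)) → Regular (λ w → ∃ λ i → L i w)
regular-⋃Fin {n = zero}  R =
  record { congruence = trivial ; respects = λ { _ (() , _) } ; member? = λ _ → no λ { (() , _) } }
regular-⋃Fin {n = suc n} R =
  regular-ext (λ { (inj₁ l) → zero , l ; (inj₂ (i , l)) → suc i , l })
              (λ { (zero , l) → inj₁ l ; (suc i , l) → inj₂ (i , l) })
              (regular-∪ (R zero) (regular-⋃Fin (R ∘ suc)))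

module _ {n : ℕ} (A↔Fin : A ↔ Fin n) where

  regular-⋃letter : {L : A → Lang A} → (∀ a → Regular (L a)) → Regular (λ w → ∃ λ a → L a w)
  regular-⋃letter {L} R =
    regular-ext (λ (i , l) → from i , l)
                (λ {w} (a , l) → to a , subst (λ a → L a w) (sym (strictlyInverseʳ a)) l)
                (regular-⋃Fin (R ∘ from))
    where open Inverse A↔Fin

  regular-⋃≤ : ∀ N {L : Word A → Lang A} → (∀ u → Regular (L u)) →
               Regular (λ w → ∃ λ u → length u ≤ N × L u w)
  regular-⋃≤ zero R =
    regular-ext (λ l → [] , z≤n , l) (λ { ([] , _ , l) → l }) (R [])
  regular-⋃≤ (suc N) R =
    regular-ext (λ { (inj₁ l) → [] , z≤n , l ; (inj₂ (a , u , le , l)) → a ∷ u , s≤s le , l })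
                (λ { ([] , _ , l) → inj₁ l ; (a ∷ u , s≤s le , l) → inj₂ (a , u , le , l) })
                (regular-∪ (R []) (regular-⋃letter λ a → regular-⋃≤ N (λ u → R (a ∷ u))))

-- Automata, star and concatenation

module _ (M : Automaton A) where
  open Automaton M

  Path : Fin states → Fin states → Lang A
  Path q r []      = q ≡ r
  Path q r (a ∷ w) = ∃ λ s → s ∈ˢ step q a × Path s r w

  Path? : ∀ q r → Decidable (Path q r)
  Path? q r []      = q Fin.≟ r
  Path? q r (a ∷ w) = Fin.any? λ s → s ∈? step q a ×-dec Path? s r w

  Path-++⁺ : ∀ {q s r} u {v} → Path q s u → Path s r v → Path q r (u ++ v)
  Path-++⁺ []      refl          π = π
  Path-++⁺ (_ ∷ u) (t , t∈ , π₁) π = t , t∈ , Path-++⁺ u π₁ π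

  Path-++⁻ : ∀ {q r} u {v} → Path q r (u ++ v) → ∃ λ s → Path q s u × Path s r v
  Path-++⁻ []      π = _ , refl , π
  Path-++⁻ (_ ∷ u) (t , t∈ , π) = let s , π₁ , π₂ = Path-++⁻ u π in s , (t , t∈ , π₁) , π₂

  AcceptedFrom⇒Path : ∀ {q} w → AcceptedFrom M q w → ∃ λ r → r ∈ˢ final × Path q r w
  AcceptedFrom⇒Path []      q∈ = _ , q∈ , refl
  AcceptedFrom⇒Path (_ ∷ w) (s , s∈ , acc) =
    let r , r∈ , π = AcceptedFrom⇒Path w acc in r , r∈ , s , s∈ , π

  Path⇒AcceptedFrom : ∀ {q r} w → r ∈ˢ final → Path q r w → AcceptedFrom M q w
  Path⇒AcceptedFrom []      r∈ refl = r∈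
  Path⇒AcceptedFrom (_ ∷ w) r∈ (s , s∈ , π) = s , s∈ , Path⇒AcceptedFrom w r∈ π

  -- The congruence is that of the transition monoid: words are equivalent when they induce the same
  -- relation on states, so nondeterminism causes no difficulty.
  regular-Recognized : Regular (Recognized M)
  regular-Recognized = regular-ext
    (λ { {w} (q , q∈ , r , r∈ , π) → q , q∈ , Path⇒AcceptedFrom w r∈ π })
    (λ { {w} (q , q∈ , acc) → q , q∈ , AcceptedFrom⇒Path w acc })
    record
      { congruence = refined
      ; respects   = λ { e (q , q∈ , r , r∈ , π) → q , q∈ , r , r∈ , refined-respects q r e π }
      ; member?    = λ w → Fin.any? λ q → q ∈? initial ×-dec Fin.any? λ r → r ∈? final ×-dec Path? q r w
      }
    where
    Path-++ : ∀ {u u′ v v′} → Congruence._≈_ trivial u u′ → Congruence._≈_ trivial v v′ →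
              (∀ q r → Path q r u → Path q r u′) → (∀ q r → Path q r v → Path q r v′) →
              ∀ q r → Path q r (u ++ v) → Path q r (u′ ++ v′)
    Path-++ {u} {u′} _ _ f g q r π =
      let s , π₁ , π₂ = Path-++⁻ u π in Path-++⁺ u′ (f q s π₁) (g s r π₂)
    open Refine trivial Path Path? Path-++

Star : Lang A → Lang A
Star L w = ∃ λ xs → All L xs × concat xs ≡ w

module _ {L : Lang A} where

  star-[] : Star L []
  star-[] = [] , [] , refl

  star-∷ : ∀ {x w} → L x → Star L w → Star L (x ++ w)
  star-∷ {x} l (xs , ls , e) = x ∷ xs , l ∷ ls , cong (x ++_) e

  star-++ : ∀ {u v} → Star L u → Star L v → Star L (u ++ v)
  star-++ (xs , ls , refl) (ys , ms , refl) = xs ++ ys , ++⁺ ls ms , sym (concat-++ xs ys)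

  -- Empty factors are skipped, so the factor split off is nonempty and `star?` can recurse on a
  -- shorter word.
  star-uncons : ∀ {a w} → Star L (a ∷ w) → ∃₂ λ s t → w ≡ s ++ t × L (a ∷ s) × Star L t
  star-uncons ([] ∷ xs , _ ∷ ls , e) = star-uncons (xs , ls , e)
  star-uncons ((a ∷ s) ∷ xs , l ∷ ls , refl) = s , concat xs , refl , l , xs , ls , refl

  -- A cut on the border of two factors counts as a cut of the next one, with `a` empty. The last
  -- alternative arises only when no factor is left after the cut.
  star-cut : ∀ r {q} → Star L (r ++ q) →
             ∃₂ λ y a → ∃₂ λ b z → r ≡ y ++ a × q ≡ b ++ z × Star L y × Star L z ×
                        (L (a ++ b) ⊎ a ≡ [] × b ≡ [])
  star-cut r {q} (xs , ls , e) = go r xs ls e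
    where
    go : ∀ r xs → All L xs → concat xs ≡ r ++ q →
         ∃₂ λ y a → ∃₂ λ b z → r ≡ y ++ a × q ≡ b ++ z × Star L y × Star L z ×
                    (L (a ++ b) ⊎ a ≡ [] × b ≡ [])
    go r [] [] e =
      [] , [] , [] , [] , ++-conicalˡ r q (sym e) , ++-conicalʳ r q (sym e) ,
      star-[] , star-[] , inj₂ (refl , refl)
    go r (x ∷ xs) (l ∷ ls) e with ++-split x r e
    ... | inj₁ (b , refl , q≡) =
      [] , r , b , concat xs , refl , q≡ , star-[] , (xs , ls , refl) , inj₁ l
    ... | inj₂ (r′ , refl , e′) with go r′ xs ls e′
    ... | y , a , b , z , refl , q≡ , sy , sz , ab =
      x ++ y , a , b , z , sym (++-assoc x y a) , q≡ , star-∷ l sy , sz , ab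

  star? : Decidable L → Decidable (Star L)
  star? L? w = go (length w) w ≤-refl
    where
    go : ∀ n w → length w ≤ n → Dec (Star L w)
    go n       []      _       = yes star-[]
    go (suc n) (a ∷ w) (s≤s l) =
      map′ (λ { (s , t , refl , ls , _ , st) → star-∷ ls st })
           (λ st → let s , t , e , ls , tst = star-uncons st in s , t , e , ls , bound s t e , tst)
           (anySplit? Q? w)
      where
      bound : ∀ s t → w ≡ s ++ t → length t ≤ n
      bound s t refl = ≤-trans (length-++-≤ʳ t {s}) l
      Q? : ∀ s t → Dec (L (a ∷ s) × length t ≤ n × Star L t)
      Q? s t with L? (a ∷ s) | length t ≤? n
      ... | no ¬l | _      = no (¬l ∘ proj₁)
      ... | yes _ | no ¬le = no (¬le ∘ proj₁ ∘ proj₂)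
      ... | yes l | yes le = map′ (λ st → l , le , st) (proj₂ ∘ proj₂) (go n t le)

-- Put into products so that the class of a word reveals whether it is empty; this is the hypothesis
-- `separates` of the next module.
emptiness : Congruence A
emptiness = record
  { size = 2
  ; class = λ { [] → zero ; (_ ∷ _) → suc zero }
  ; ++-congruent = λ { {[]} {[]} _ q → q ; {_ ∷ _} {_ ∷ _} _ _ → refl
                     ; {[]} {_ ∷ _} () _ ; {_ ∷ _} {[]} () _ }
  }

emptiness-[] : ∀ (w : Word A) → Congruence._≈_ emptiness w [] → w ≡ []
emptiness-[] [] _ = refl

regular-[] : Regular {A} (_≡ [])
regular-[] = record
  { congruence = emptiness
  ; respects   = λ { {_} {v} e refl → emptiness-[] v (sym e) }
  ; member?    = λ { [] → yes refl ; (_ ∷ _) → no λ () }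
  }

-- The words s y p with y ∈ L*, recorded by the classes of s and p; cutting such
-- a word in two cuts at most one factor of y, which is seen by its two classes.
module StarFactorizations {A : Set} (C : Congruence A)
  (separates : ∀ w → Congruence._≈_ C w [] → w ≡ [])
  {L : Lang A} (L-respects : L Respects (Congruence._≈_ C)) (L? : Decidable L) where

  open Congruence C using (_≈_; class; size; ++-congruent)

  Framed : Fin size → Fin size → Lang A
  Framed c d w = ∃₂ λ s t → w ≡ s ++ t × (class s ≡ c × ∃₂ λ y p → t ≡ y ++ p × (Star L y × class p ≡ d))

  Framed? : ∀ c d → Decidable (Framed c d)
  Framed? c d = anySplit? λ s t → class s Fin.≟ c ×-dec anySplit? (λ y p → star? L? y ×-dec class p Fin.≟ d) t

  framed : ∀ s y p {c d w} → class s ≡ c → Star L y → class p ≡ d → s ++ y ++ p ≡ w → Framed c d w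
  framed s y p cs st dp e = s , y ++ p , sym e , cs , y , p , refl , st , dp

  private
    assoc₁ : ∀ (s y f v : Word A) → s ++ y ++ (f ++ v) ≡ (s ++ y ++ f) ++ v
    assoc₁ s y f v = solve (++-monoid A)

    assoc₂ : ∀ (s y a b z p : Word A) → s ++ (y ++ (a ++ b) ++ z) ++ p ≡ (s ++ y ++ a) ++ (b ++ z ++ p)
    assoc₂ s y a b z p = solve (++-monoid A)

  -- The clauses treat a cut inside `s`, inside `p` and inside `y`. In the first two, one half is
  -- reframed by its own hypothesis while the other half just prolongs a frame and is replaced by an
  -- equivalent word. In the third both halves are reframed, the pieces `a` and `b` of the cut
  -- factor serving as right frame of `u` and left frame of `v`.
  Framed-++ : ∀ {u u′ v v′} → u ≈ u′ → v ≈ v′ →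
              (∀ c d → Framed c d u → Framed c d u′) → (∀ c d → Framed c d v → Framed c d v′) →
              ∀ c d → Framed c d (u ++ v) → Framed c d (u′ ++ v′)
  Framed-++ {u} {u′} {v} {v′} eu ev fu fv c d (s , t , e , cs , y , p , refl , st , dp)
    with ++-split u s e
  ... | inj₂ (r , refl , v≡) with fv (class r) d (framed r y p refl st dp (sym v≡))
  ...   | r′ , _ , refl , cr , y′ , p′ , refl , st′ , dp′ =
        framed (u′ ++ r′) y′ p′ (trans (sym (++-congruent eu (sym cr))) cs) st′ dp′ (++-assoc u′ r′ (y′ ++ p′))
  Framed-++ {u} {u′} {v} {v′} eu ev fu fv c d (s , t , e , cs , y , p , refl , st , dp)
    | inj₁ (r , refl , yp≡) with ++-split y r yp≡
  ... | inj₂ (f , refl , p≡) with fu c (class f) (framed s y f cs st refl refl)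
  ...   | s′ , _ , refl , cs′ , y′ , f′ , refl , st′ , cf =
        framed s′ y′ (f′ ++ v′) cs′ st′
          (trans (++-congruent cf (sym ev)) (trans (cong class (sym p≡)) dp)) (assoc₁ s′ y′ f′ v′)
  Framed-++ {u} {u′} {v} {v′} eu ev fu fv c d (s , t , e , cs , y , p , refl , st , dp)
    | inj₁ (r , refl , yp≡) | inj₁ (f , refl , refl) with star-cut r st
  ... | y₁ , a , b , z , refl , refl , sy₁ , sz , ab
    with fu c (class a) (framed s y₁ a cs sy₁ refl refl)
       | fv (class b) d (framed b z p refl sz dp (sym (++-assoc b z p)))
  ... | s′ , _ , refl , cs′ , y′ , a′ , refl , sy′ , ca
      | b′ , _ , refl , cb , z′ , p′ , refl , sz′ , dp′ =
        framed s′ (y′ ++ (a′ ++ b′) ++ z′) p′ cs′ (star-++ sy′ (star-++ (middle ab) sz′)) dp′ (assoc₂ s′ y′ a′ b′ z′ p′)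
    where
    -- The pieces found in `u′` and `v′` are only equivalent to `a` and `b`; saturation of `L` makes
    -- them fit together again.
    middle : L (a ++ b) ⊎ a ≡ [] × b ≡ [] → Star L (a′ ++ b′)
    middle (inj₁ l) =
      subst (Star L) (++-identityʳ (a′ ++ b′)) (star-∷ (L-respects (++-congruent (sym ca) (sym cb)) l) star-[])
    middle (inj₂ (refl , refl)) =
      subst (Star L) (sym (cong₂ _++_ (separates a′ ca) (separates b′ cb))) star-[]

  open Refine C Framed Framed? Framed-++ public

module _ {K L N : Lang A} (R : Regular K) (S : Regular L) (T : Regular N) where

  private
    C = congruence R ⊗ congruence S ⊗ congruence T ⊗ emptiness
    C₁ = congruence S ⊗ congruence T ⊗ emptiness
    C₂ = congruence T ⊗ emptiness
    open Congruence C using (_≈_; class)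

    K-respects : K Respects _≈_
    K-respects = ⊗-respectsˡ (congruence R) C₁ (respects R)
    L-respects : L Respects _≈_
    L-respects = ⊗-respectsʳ (congruence R) C₁ (⊗-respectsˡ (congruence S) C₂ (respects S))
    N-respects : N Respects _≈_
    N-respects = ⊗-respectsʳ (congruence R) C₁
      (⊗-respectsʳ (congruence S) C₂ (⊗-respectsˡ (congruence T) emptiness (respects T)))
    []-respects : (_≡ []) Respects _≈_
    []-respects = ⊗-respectsʳ (congruence R) C₁
      (⊗-respectsʳ (congruence S) C₂ (⊗-respectsʳ (congruence T) emptiness (respects regular-[])))
    open StarFactorizations C (λ w e → []-respects (sym e) refl) L-respects (member? S)

  -- One closure property for K L* N serves all later needs: the star takes K = N = {ε}, the product
  -- takes L empty, which forces `y` to be empty.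
  regular-cat-star-cat : Regular (λ w → ∃₂ λ s t → w ≡ s ++ t × (K s × ∃₂ λ y p → t ≡ y ++ p × (Star L y × N p)))
  regular-cat-star-cat = record
    { congruence = refined
    ; respects   = λ { e (s , _ , refl , k , y , p , refl , st , n) →
        let s′ , t′ , e₁ , cs , y′ , p′ , e₂ , st′ , dp =
              refined-respects (class s) (class p) e (framed s y p refl st refl refl)
        in s′ , t′ , e₁ , K-respects (sym cs) k , y′ , p′ , e₂ , st′ , N-respects (sym dp) n }
    ; member?    = anySplit? λ s t → member? R s ×-dec anySplit? (λ y p → star? (member? S) y ×-dec member? T p) t
    }

regular-star : {L : Lang A} → Regular L → Regular (Star L)
regular-star {L = L} R = regular-ext
  (λ { (_ , _ , refl , refl , y , _ , refl , st , refl) → subst (Star L) (sym (++-identityʳ y)) st })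
  (λ {w} st → [] , w , refl , refl , w , [] , sym (++-identityʳ w) , st , refl)
  (regular-cat-star-cat regular-[] R regular-[])

regular-star-cat : {L N : Lang A} → Regular L → Regular N →
                   Regular (λ w → ∃₂ λ y p → w ≡ y ++ p × (Star L y × N p))
regular-star-cat R S = regular-ext
  (λ { (_ , _ , refl , refl , yp) → yp })
  (λ {w} yp → [] , w , refl , refl , yp)
  (regular-cat-star-cat regular-[] R S)

regular-cat : {K L : Lang A} → Regular K → Regular L → Regular (λ w → ∃₂ λ s t → w ≡ s ++ t × (K s × L t))
regular-cat {K = K} {L} R S = regular-ext
  (λ { (s , _ , refl , k , _ , t , refl , ([] , [] , refl) , l) → s , t , refl , k , l
     ; (_ , _ , _ , _ , _ , _ , _ , (_ ∷ _ , () ∷ _ , _) , _) })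
  (λ { (s , t , refl , k , l) → s , t , refl , k , [] , t , refl , star-[] , l })
  (regular-cat-star-cat {L = λ _ → ⊥} R (regular-const (no λ ())) S)

module _ (_≟_ : DecidableEquality A) where

  -- The quotient is the three-element monoid of a unit (the empty word), the class of `[ a ]`, and
  -- a zero for all other words.
  regular-letter : ∀ a → Regular (_≡ [ a ])
  regular-letter a = record
    { congruence = record { size = 3 ; class = cls ; ++-congruent = λ {u} {u′} {v} {v′} → cls-++ u u′ v v′ }
    ; respects   = λ { {u} {v} e refl → inv v (trans (sym e) cls-a) }
    ; member?    = λ w → ≡-dec _≟_ w [ a ]
    }
    where
    cls : Word A → Fin 3
    cls []          = zero
    cls (b ∷ [])    with b ≟ a
    ... | yes _ = suc zero
    ... | no _  = suc (suc zero)
    cls (_ ∷ _ ∷ _) = suc (suc zero)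
    cls-a : cls [ a ] ≡ suc zero
    cls-a with a ≟ a
    ... | yes _ = refl
    ... | no ¬p = contradiction refl ¬p
    inv : ∀ v → cls v ≡ suc zero → v ≡ [ a ]
    inv (b ∷ []) e with b ≟ a
    inv (b ∷ []) e | yes refl = refl
    _·_ : Fin 3 → Fin 3 → Fin 3
    zero  · j    = j
    suc i · zero = suc i
    suc i · suc j = suc (suc zero)
    homo : ∀ u v → cls (u ++ v) ≡ cls u · cls v
    homo []          v = refl
    homo (b ∷ [])    [] with b ≟ a
    ... | yes _ = refl
    ... | no _  = refl
    homo (b ∷ [])    (c ∷ []) with b ≟ a | c ≟ a
    ... | yes _ | yes _ = refl
    ... | yes _ | no _  = refl
    ... | no _  | yes _ = refl
    ... | no _  | no _  = refl
    homo (b ∷ [])    (_ ∷ _ ∷ _) with b ≟ a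
    ... | yes _ = refl
    ... | no _  = refl
    homo (_ ∷ _ ∷ _) [] = refl
    homo (_ ∷ _ ∷ _) (c ∷ []) with c ≟ a
    ... | yes _ = refl
    ... | no _  = refl
    homo (_ ∷ _ ∷ _) (_ ∷ _ ∷ _) = refl
    cls-++ : ∀ u u′ v v′ → cls u ≡ cls u′ → cls v ≡ cls v′ → cls (u ++ v) ≡ cls (u′ ++ v′)
    cls-++ u u′ v v′ p q = trans (homo u v) (trans (cong₂ _·_ p q) (sym (homo u′ v′)))

  regular-word : ∀ w → Regular (_≡ w)
  regular-word []      = regular-[]
  regular-word (a ∷ w) = regular-ext
    (λ { (_ , _ , refl , refl , refl) → refl })
    (λ { refl → [ a ] , w , refl , refl , refl })
    (regular-cat (regular-letter a) (regular-word w))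

-- Decidability of being a code

-- Two factorizations of one word that first differ in the factors x and x r leave
-- r t ∈ L* with t ∈ L*.
Overlap : Lang A → Lang A
Overlap L r = r ≢ [] × ∃ (λ x → L x × L (x ++ r)) × ∃ (λ t → Star L t × Star L (r ++ t))

code-[]∉ : {L : Lang A} → IsCode L → ¬ L []
code-[]∉ code l with code [ [] ] [] (l ∷ []) [] refl
... | ()

code-no-overlap : {L : Lang A} → IsCode L → ¬ ∃ (Overlap L)
code-no-overlap code (r , r≢[] , (x , lx , lxr) , t , (ts , tsL , refl) , (us , usL , e)) =
  r≢[] (++-identityʳ-unique x (sym (proj₁ (∷-injective xr∷ts≡x∷us))))
  where
  xr∷ts≡x∷us : (x ++ r) ∷ ts ≡ x ∷ us
  xr∷ts≡x∷us = code ((x ++ r) ∷ ts) (x ∷ us) (lxr ∷ tsL) (lx ∷ usL)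
                 (trans (++-assoc x r (concat ts)) (cong (x ++_) (sym e)))

no-overlap-code : {L : Lang A} → ¬ L [] → ¬ ∃ (Overlap L) → IsCode L
no-overlap-code {L = L} []∉ ¬overlap = go
  where
  go : IsCode L
  go [] [] _ _ _ = refl
  go [] (y ∷ ys) _ (ly ∷ _) e with ++-conicalˡ y (concat ys) (sym e)
  ... | refl = contradiction ly []∉
  go (x ∷ xs) [] (lx ∷ _) _ e with ++-conicalˡ x (concat xs) e
  ... | refl = contradiction lx []∉
  go (x ∷ xs) (y ∷ ys) (lx ∷ lxs) (ly ∷ lys) e with ++-split x y e
  ... | inj₁ ([] , x≡ , e′) =
    cong₂ _∷_ (trans x≡ (++-identityʳ y)) (go xs ys lxs lys (sym e′))
  ... | inj₁ (a ∷ r , refl , e′) = contradiction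
    (a ∷ r , (λ ()) , (y , ly , lx) , concat xs , (xs , lxs , refl) , (ys , lys , e′)) ¬overlap
  ... | inj₂ ([] , y≡ , e′) =
    cong₂ _∷_ (sym (trans y≡ (++-identityʳ x))) (go xs ys lxs lys e′)
  ... | inj₂ (a ∷ r , refl , e′) = contradiction
    (a ∷ r , (λ ()) , (x , lx , ly) , concat ys , (ys , lys , refl) , (xs , lxs , e′)) ¬overlap

module _ (any : Searchable A) where

  -- The quantified words `x` and `t` matter only up to their classes, so each quantifier is a
  -- finite search, whose outcome depends only on the class of `r`. This takes the place of the
  -- iteration of Sardinas and Patterson.
  regular-Overlap : {L : Lang A} → Regular L → Regular (Overlap L)
  regular-Overlap {L} R =
    regular-∩ (regular-∁ regular-[]) (regular-∩ (gaps R) (shifts (regular-star R)))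
    where
    gaps : ∀ {L : Lang A} → Regular L → Regular (λ r → ∃ λ x → L x × L (x ++ r))
    gaps R = record
      { congruence = congruence R
      ; respects   = λ { e (x , l , lr) → x , l , respects R (Regular.++-congˡ R x e) lr }
      ; member?    = λ r → Regular.anyWord? R any
          (λ { e (l , lr) → respects R e l , respects R (Regular.++-congʳ R r e) lr })
          (λ x → member? R x ×-dec member? R (x ++ r))
      }
    shifts : ∀ {L : Lang A} → Regular L → Regular (λ r → ∃ λ t → L t × L (r ++ t))
    shifts R = record
      { congruence = congruence R
      ; respects   = λ { e (t , l , lr) → t , l , respects R (Regular.++-congʳ R t e) lr }
      ; member?    = λ r → Regular.anyWord? R any
          (λ { e (l , lr) → respects R e l , respects R (Regular.++-congˡ R r e) lr })
          (λ t → member? R t ×-dec member? R (r ++ t))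
      }

  isCode? : {L : Lang A} → Regular L → Dec (IsCode L)
  isCode? R = map′
    (λ ([]∉ , ¬overlap) → no-overlap-code []∉ ¬overlap)
    (λ code → code-[]∉ code , code-no-overlap code)
    (¬? (member? R []) ×-dec ¬? (nonempty? any (regular-Overlap R)))

-- Equations u f v ≡ u′ f v′ in the unknown f

-- The theorem of Lyndon and Schützenberger: f lies in (ab)*a, where the conjugates are ab and ba.
-- As the left word is nonempty, stripping it from `f` terminates.
conjugacy⁻ : ∀ c (r f s : Word A) → (c ∷ r) ++ f ≡ f ++ s →
             ∃₂ λ a b → c ∷ r ≡ a ++ b × s ≡ b ++ a ×
                        ∃₂ λ y p → f ≡ y ++ p × (Star (_≡ a ++ b) y × p ≡ a)
conjugacy⁻ c r f s e = go (length f) f ≤-refl e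
  where
  go : ∀ n f → length f ≤ n → (c ∷ r) ++ f ≡ f ++ s →
       ∃₂ λ a b → c ∷ r ≡ a ++ b × s ≡ b ++ a ×
                  ∃₂ λ y p → f ≡ y ++ p × (Star (_≡ a ++ b) y × p ≡ a)
  go n f l e with ++-split (c ∷ r) f e
  go n f l e | inj₁ (b , cr≡ , s≡) = f , b , cr≡ , s≡ , [] , f , refl , star-[] , refl
  go (suc n) f (s≤s l) e | inj₂ (g , refl , e′)
    with go n g (≤-trans (length-++-≤ʳ g {r}) l) e′
  ... | a , b , cr≡ , s≡ , y , p , refl , st , p≡ =
    a , b , cr≡ , s≡ , (c ∷ r) ++ y , p , sym (++-assoc (c ∷ r) y p) , star-∷ cr≡ st , p≡

conjugacy⁺ : ∀ (a b : Word A) {y p} → Star (_≡ a ++ b) y → p ≡ a →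
             (a ++ b) ++ (y ++ p) ≡ (y ++ p) ++ (b ++ a)
conjugacy⁺ a b ([] , [] , refl) refl = ++-assoc a b a
conjugacy⁺ {A} a b (_ ∷ xs , refl ∷ ls , refl) refl =
  trans (cong ((a ++ b) ++_) (trans (++-assoc (a ++ b) (concat xs) a) (conjugacy⁺ a b (xs , ls , refl) refl)))
        (assoc (concat xs))
  where
  assoc : ∀ y → (a ++ b) ++ (y ++ a) ++ (b ++ a) ≡ (((a ++ b) ++ y) ++ a) ++ (b ++ a)
  assoc y = solve (++-monoid A)

infix-tail-[] : ∀ (r f s : Word A) → f ≡ r ++ f ++ s → s ≡ []
infix-tail-[] r f []      _ = refl
infix-tail-[] r f (c ∷ s) e = contradiction (cong length e) (<⇒≢ (begin-strict
  length f                       <⟨ m<m+n (length f) (s≤s z≤n) ⟩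
  length f + length (c ∷ s)      ≡⟨ length-++ f ⟨
  length (f ++ c ∷ s)            ≤⟨ length-++-≤ʳ (f ++ c ∷ s) {r} ⟩
  length (r ++ f ++ c ∷ s)       ∎))
  where open ≤-Reasoning

module _ {n : ℕ} (A↔Fin : A ↔ Fin n) (_≟_ : DecidableEquality A) where

  private
    _≟ʷ_ : DecidableEquality (Word A)
    _≟ʷ_ = ≡-dec _≟_

  -- For empty `r` the equation holds for all `f` or for none. Otherwise `a` and `b` are factors of
  -- `r`, which bounds their lengths and makes the union finite.
  regular-conjugator : ∀ r s → Regular (λ f → r ++ f ≡ f ++ s)
  regular-conjugator [] s = regular-ext
    (λ { {w} refl → sym (++-identityʳ w) })
    (λ {w} e → ++-identityʳ-unique w e)
    (regular-const (s ≟ʷ []))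
  regular-conjugator r@(c ∷ r₀) s = regular-ext
    (λ { (a , _ , b , _ , (r≡ , refl) , _ , _ , refl , st , refl) →
         trans (cong (_++ _) r≡) (conjugacy⁺ a b st refl) })
    (λ {f} e → let a , b , r≡ , s≡ , yp = conjugacy⁻ c r₀ f s e in
       a , ≤-trans (length-++-≤ˡ a) (≤-reflexive (cong length (sym r≡))) ,
       b , ≤-trans (length-++-≤ʳ b {a}) (≤-reflexive (cong length (sym r≡))) ,
       (r≡ , s≡) , yp)
    (regular-⋃≤ A↔Fin (length r) λ a → regular-⋃≤ A↔Fin (length r) λ b →
       regular-∩ (regular-const (r ≟ʷ (a ++ b) ×-dec s ≟ʷ (b ++ a)))
                 (regular-star-cat (regular-word _≟_ (a ++ b)) (regular-word _≟_ a)))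

  regular-shift : ∀ r v v′ → Regular (λ f → r ++ f ++ v ≡ f ++ v′)
  regular-shift r v v′ = regular-ext
    (λ { {f} (s , _ , refl , e) → trans (sym (++-assoc r f v)) (trans (cong (_++ v) e) (++-assoc f s v)) })
    (λ {f} e → let s , v′≡ , e′ = suffix f e in
       s , ≤-trans (length-++-≤ˡ s) (≤-reflexive (cong length (sym v′≡))) , v′≡ , e′)
    (regular-⋃≤ A↔Fin (length v′) λ s →
       regular-∩ (regular-const (v′ ≟ʷ (s ++ v))) (regular-conjugator r s))
    where
    suffix : ∀ f → r ++ f ++ v ≡ f ++ v′ → ∃ λ s → v′ ≡ s ++ v × r ++ f ≡ f ++ s
    suffix f e with ++-split f (r ++ f) (trans (sym e) (sym (++-assoc r f v)))
    ... | inj₂ (s , rf≡ , v′≡) = s , v′≡ , rf≡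
    -- Here `f` would extend `r ++ f`, so the surplus `s` is empty and `v′` equals `v`.
    ... | inj₁ (s , f≡ , v≡) with infix-tail-[] r f s (trans f≡ (++-assoc r f s))
    ...   | refl = [] , sym v≡ , trans (sym (++-identityʳ (r ++ f))) (trans (sym f≡) (sym (++-identityʳ f)))

  -- Of `u` and `u′` one is a prefix of the other; cancelling it leaves an equation with a single
  -- word to the left of `f`.
  regular-equation : ∀ u v u′ v′ → Regular (λ f → u ++ f ++ v ≡ u′ ++ f ++ v′)
  regular-equation u v u′ v′ = regular-ext
    (λ { {f} (inj₁ (r , _ , refl , e)) → trans (++-assoc u′ r (f ++ v)) (cong (u′ ++_) e)
       ; {f} (inj₂ (r , _ , refl , e)) → trans (cong (u ++_) (sym e)) (sym (++-assoc u r (f ++ v′))) })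
    cases
    (regular-∪
      (regular-⋃≤ A↔Fin (length u) λ r → regular-∩ (regular-const (u ≟ʷ (u′ ++ r))) (regular-shift r v v′))
      (regular-⋃≤ A↔Fin (length u′) λ r → regular-∩ (regular-const (u′ ≟ʷ (u ++ r))) (regular-shift r v′ v)))
    where
    cases : ∀ {f} → u ++ f ++ v ≡ u′ ++ f ++ v′ →
            (∃ λ r → length r ≤ length u × u ≡ u′ ++ r × r ++ f ++ v ≡ f ++ v′) ⊎
            (∃ λ r → length r ≤ length u′ × u′ ≡ u ++ r × r ++ f ++ v′ ≡ f ++ v)
    cases e with ++-split u u′ e
    ... | inj₁ (r , u≡ , e′) = inj₁ (r , ≤-trans (length-++-≤ʳ r {u′}) (≤-reflexive (cong length (sym u≡))) , u≡ , sym e′)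
    ... | inj₂ (r , u′≡ , e′) = inj₂ (r , ≤-trans (length-++-≤ʳ r {u}) (≤-reflexive (cong length (sym u′≡))) , u′≡ , sym e′)

-- The prefix and factor distances

-- Takes `j` letters off the outer ends of a pair of margins, from `u` as long as it lasts and then
-- from the end of `v`.
trim : ∀ (u v : Word A) j → j ≤ length u + length v →
       ∃₂ λ u₁ u₂ → ∃₂ λ v₁ v₂ → u ≡ u₁ ++ u₂ × v ≡ v₂ ++ v₁ × length u₁ + length v₁ ≡ j
trim []      v j       l =
  [] , [] , drop (length v ∸ j) v , take (length v ∸ j) v , refl , sym (take++drop≡id (length v ∸ j) v) ,
  trans (length-drop (length v ∸ j) v) (m∸[m∸n]≡n l)
trim (c ∷ u) v zero    l = [] , c ∷ u , [] , v , refl , sym (++-identityʳ v) , refl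
trim (c ∷ u) v (suc j) (s≤s l) =
  let u₁ , u₂ , v₁ , v₂ , u≡ , v≡ , len = trim u v j l
  in c ∷ u₁ , u₂ , v₁ , v₂ , cong (c ∷_) u≡ , v≡ , cong suc len

longest : Searchable A → {P : Word A → Set} → Decidable P → ∃ P →
          ∀ N → (∀ w → P w → length w ≤ N) → ∃ (IsLongest P)
longest any P? (w , p) zero    bound = w , p , λ v q → ≤-trans (bound v q) z≤n
longest any P? ∃p      (suc N) bound
  with anyUpTo? any (suc N) (λ w → P? w ×-dec length w ℕ.≟ suc N)
... | yes (w , _ , p , len) = w , p , λ v q → ≤-trans (bound v q) (≤-reflexive (sym len))
... | no ¬∃ = longest any P? ∃p N λ w p →
  s≤s⁻¹ (≤∧≢⇒< (bound w p) λ len → ¬∃ (w , bound w p , p , len))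

-- For Side = (_≡ []) the relation Near k is 𝒫 k, and for Side = all words it is ℱ k.
module Nearness {A : Set} (Side : Word A → Set) (side? : Decidable Side) (side-[] : Side [])
  (side-++⁺ : ∀ {u v} → Side u → Side v → Side (u ++ v))
  (side-++⁻ : ∀ u {v} → Side (u ++ v) → Side u × Side v) where

  -- The common part `f` is arbitrary rather than longest: every choice bounds the distance from
  -- above, and this existential form is the one that composes.
  record Near (k : ℕ) (x y : Word A) : Set where
    constructor near
    field
      f u v u′ v′ : Word A
      side  : Side u
      side′ : Side u′
      bound : (length u + length v) + (length u′ + length v′) ≤ k
      x≡    : x ≡ u ++ f ++ v
      y≡    : y ≡ u′ ++ f ++ v′

  near-refl : ∀ {k x} → Near k x x
  near-refl {x = x} = near x [] [] [] [] side-[] side-[] z≤n (sym (++-identityʳ x)) (sym (++-identityʳ x))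

  near-sym : ∀ {k x y} → Near k x y → Near k y x
  near-sym (near f u v u′ v′ s s′ b x≡ y≡) =
    near f u′ v′ u v s′ s (≤-trans (≤-reflexive (+-comm (length u′ + length v′) _)) b) y≡ x≡

  private
    -- `h` is the intersection of the occurrences of `f` and `g` in one word, `f` being a prefix of
    -- it.
    overlapʳ : ∀ f v α g t → f ++ v ≡ α ++ g ++ t → Side α →
               ∃₂ λ h α′ → ∃₂ λ β δ → f ≡ α′ ++ h ++ β × g ≡ h ++ δ × Side α′ ×
                 (length α′ + length β) + length δ ≤ length v + (length α + length t)
    overlapʳ f v α g t e sα with ++-split f α e
    -- Disjoint occurrences: `f` lies within `α` and `g` within `v`, which pays for losing both
    -- entirely.
    ... | inj₂ (r , refl , refl) = [] , [] , f , g , refl , refl , side-[] , (begin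
      length f + length g                                             ≤⟨ m≤m+n _ _ ⟩
      (length f + length g) + (length r + length r + length t + length t)
        ≡⟨ rearrange (length f) (length g) (length r) (length t) ⟩
      (length r + (length g + length t)) + ((length f + length r) + length t)
        ≡⟨ cong₂ (λ a b → a + (b + length t)) (trans (length-++ r) (cong (length r +_) (length-++ g))) (length-++ f) ⟨
      length (r ++ g ++ t) + (length (f ++ r) + length t)             ∎)
      where
      open ≤-Reasoning
      rearrange : ∀ f g r t → (f + g) + (r + r + t + t) ≡ (r + (g + t)) + ((f + r) + t)
      rearrange = solve-∀
    ... | inj₁ (r , refl , e′) with ++-split g r e′
    ...   | inj₁ (δ , refl , refl) = r , α , [] , δ , cong (α ++_) (sym (++-identityʳ r)) , refl , sα , (begin
      (length α + 0) + length δ                                 ≤⟨ m≤m+n _ _ ⟩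
      (length α + 0) + length δ + (length t + length t)          ≡⟨ rearrange (length α) (length δ) (length t) ⟩
      (length δ + length t) + (length α + length t)             ≡⟨ cong (_+ _) (length-++ δ) ⟨
      length (δ ++ t) + (length α + length t)                   ∎)
      where
      open ≤-Reasoning
      rearrange : ∀ a d t → (a + 0) + d + (t + t) ≡ (d + t) + (a + t)
      rearrange = solve-∀
    ...   | inj₂ (β , refl , refl) = g , α , β , [] , refl , sym (++-identityʳ g) , sα , (begin
      (length α + length β) + 0                                ≤⟨ m≤m+n _ _ ⟩
      (length α + length β) + 0 + (length v + length v)        ≡⟨ rearrange (length α) (length β) (length v) ⟩
      length v + (length α + (length β + length v))            ≡⟨ cong (λ b → length v + (length α + b)) (length-++ β) ⟨
      length v + (length α + length (β ++ v))                  ∎)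
      where
      open ≤-Reasoning
      rearrange : ∀ a b v → (a + b) + 0 + (v + v) ≡ v + (a + (b + v))
      rearrange = solve-∀

    Overlaps : (f u v g s t : Word A) → Set
    Overlaps f u v g s t = ∃₂ λ h α → ∃₂ λ β γ → ∃ λ δ →
      f ≡ α ++ h ++ β × g ≡ γ ++ h ++ δ × Side α × Side γ ×
      (length α + length β) + (length γ + length δ) ≤ (length u + length v) + (length s + length t)

    overlaps : ∀ f u v g s t → Side u → Side s → u ++ f ++ v ≡ s ++ g ++ t → Overlaps f u v g s t
    overlaps f u v g s t su ss e with ++-split u s e
    ... | inj₂ (r , refl , e′) with overlapʳ f v r g t e′ (proj₂ (side-++⁻ u ss))
    ... | h , α , β , δ , f≡ , g≡ , sα , b = h , α , β , [] , δ , f≡ , g≡ , sα , side-[] ,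
      ≤-trans b (begin
        length v + (length r + length t)                                  ≤⟨ m≤m+n _ _ ⟩
        length v + (length r + length t) + (length u + length u)          ≡⟨ rearrange (length v) (length r) (length t) (length u) ⟩
        (length u + length v) + ((length u + length r) + length t)        ≡⟨ cong (λ a → (length u + length v) + (a + length t)) (length-++ u) ⟨
        (length u + length v) + (length (u ++ r) + length t)              ∎)
      where
      open ≤-Reasoning
      rearrange : ∀ v r t u → v + (r + t) + (u + u) ≡ (u + v) + ((u + r) + t)
      rearrange = solve-∀
    overlaps f u v g s t su ss e | inj₁ (r , refl , e′)
      with overlapʳ g t r f v e′ (proj₂ (side-++⁻ s su))
    ... | h , γ , δ , β , g≡ , f≡ , sγ , b = h , [] , β , γ , δ , f≡ , g≡ , side-[] , sγ ,
      (begin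
        length β + (length γ + length δ)                                  ≡⟨ +-comm (length β) _ ⟩
        (length γ + length δ) + length β                                  ≤⟨ b ⟩
        length t + (length r + length v)                                  ≤⟨ m≤m+n _ _ ⟩
        length t + (length r + length v) + (length s + length s)          ≡⟨ rearrange (length t) (length r) (length v) (length s) ⟩
        ((length s + length r) + length v) + (length s + length t)        ≡⟨ cong (λ a → (a + length v) + (length s + length t)) (length-++ s) ⟨
        (length (s ++ r) + length v) + (length s + length t)              ∎)
      where
      open ≤-Reasoning
      rearrange : ∀ t r v s → t + (r + v) + (s + s) ≡ ((s + r) + v) + (s + t)
      rearrange = solve-∀

    regroup : ∀ (u α h β v : Word A) → u ++ (α ++ h ++ β) ++ v ≡ (u ++ α) ++ h ++ (β ++ v)
    regroup u α h β v = solve (++-monoid A)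

  -- Inside `z` the two common factors meet in some `h` with |h| ≥ |f| + |g| - |z|. Hence what `f`
  -- and `g` lose in passing to `h` is at most the number of letters of `z` outside `f` plus the
  -- number outside `g`.
  near-trans : ∀ {k l x y z} → Near k x z → Near l z y → Near (k + l) x y
  near-trans {k} {l} (near f u v u′ v′ su su′ b refl refl) (near g s′ t′ s t ss′ ss c z≡ refl)
    with overlaps f u′ v′ g s′ t′ su′ ss′ z≡
  ... | h , α , β , γ , δ , refl , refl , sα , sγ , o =
    near h (u ++ α) (β ++ v) (s ++ γ) (δ ++ t) (side-++⁺ su sα) (side-++⁺ ss sγ)
      (begin
        (length (u ++ α) + length (β ++ v)) + (length (s ++ γ) + length (δ ++ t))
          ≡⟨ cong₂ _+_ (cong₂ _+_ (length-++ u) (length-++ β)) (cong₂ _+_ (length-++ s) (length-++ δ)) ⟩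
        ((length u + length α) + (length β + length v)) + ((length s + length γ) + (length δ + length t))
          ≡⟨ gather (length u) (length α) (length β) (length v) (length s) (length γ) (length δ) (length t) ⟩
        ((length α + length β) + (length γ + length δ)) + ((length u + length v) + (length s + length t))
          ≤⟨ +-mono-≤ o ≤-refl ⟩
        ((length u′ + length v′) + (length s′ + length t′)) + ((length u + length v) + (length s + length t))
          ≡⟨ exchange (length u′ + length v′) (length s′ + length t′) (length u + length v) (length s + length t) ⟩
        ((length u + length v) + (length u′ + length v′)) + ((length s′ + length t′) + (length s + length t))
          ≤⟨ +-mono-≤ b c ⟩
        k + l ∎)
      (regroup u α h β v) (regroup s γ h δ t)
    where
    open ≤-Reasoning
    gather : ∀ u a b v s c d t → ((u + a) + (b + v)) + ((s + c) + (d + t)) ≡ ((a + b) + (c + d)) + ((u + v) + (s + t))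
    gather = solve-∀
    exchange : ∀ p q r s → (p + q) + (r + s) ≡ (r + p) + (q + s)
    exchange = solve-∀

  private
    midpointˡ : ∀ {k x y} (n : Near (k + k) x y) → k ≤ length (Near.u n) + length (Near.v n) →
                ∃ λ z → Near k x z × Near k z y
    midpointˡ {k} (near f u v u′ v′ su su′ b refl refl) l with trim u v k l
    ... | u₁ , u₂ , v₁ , v₂ , refl , refl , len =
      u₂ ++ f ++ v₂ ,
      near (u₂ ++ f ++ v₂) u₁ v₁ [] [] (proj₁ (side-++⁻ u₁ su)) side-[]
        (≤-reflexive (trans (+-identityʳ _) len)) (regroup′ u₁ u₂ f v₂ v₁) (sym (++-identityʳ _)) ,
      near f u₂ v₂ u′ v′ (proj₂ (side-++⁻ u₁ su)) su′
        (+-cancelˡ-≤ k _ _ (≤-trans (≤-reflexive total) b)) refl refl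
      where
      regroup′ : ∀ (u₁ u₂ f v₂ v₁ : Word A) → (u₁ ++ u₂) ++ f ++ (v₂ ++ v₁) ≡ u₁ ++ (u₂ ++ f ++ v₂) ++ v₁
      regroup′ u₁ u₂ f v₂ v₁ = solve (++-monoid A)
      exchange : ∀ a b c d e → (a + b) + ((c + d) + e) ≡ ((a + c) + (d + b)) + e
      exchange = solve-∀
      total : k + ((length u₂ + length v₂) + (length u′ + length v′)) ≡
              (length (u₁ ++ u₂) + length (v₂ ++ v₁)) + (length u′ + length v′)
      total = trans (cong (_+ _) (sym len))
        (trans (exchange (length u₁) (length v₁) (length u₂) (length v₂) _)
               (cong (_+ (length u′ + length v′)) (sym (cong₂ _+_ (length-++ u₁) (length-++ v₂)))))

  -- Think of the path from `x` to `y` that deletes the margins of `x` down to `f` and then grows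
  -- those of `y`. If both margins cost at most `k`, then `f` is a midpoint; otherwise stop after
  -- `k` letters on the side whose margin is longer.
  near-midpoint : ∀ {k x y} → Near (k + k) x y → ∃ λ z → Near k x z × Near k z y
  near-midpoint {k} n@(near f u v u′ v′ su su′ b refl refl)
    with length u + length v ≤? k | length u′ + length v′ ≤? k
  ... | yes l | yes l′ =
    f , near f u v [] [] su side-[] (≤-trans (≤-reflexive (+-identityʳ _)) l) refl (sym (++-identityʳ f))
      , near f [] [] u′ v′ side-[] su′ l′ (sym (++-identityʳ f)) refl
  ... | no ¬l | _     = midpointˡ n (<⇒≤ (≰⇒> ¬l))
  ... | yes _ | no ¬l′ =
    let z , y~z , z~x = midpointˡ (near-sym n) (<⇒≤ (≰⇒> ¬l′)) in z , near-sym z~x , near-sym y~z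

  module _ {n : ℕ} (A↔Fin : A ↔ Fin n) (_≟ᴬ_ : DecidableEquality A) {X : Lang A} (R : Regular X) where

    private
      any : Searchable A
      any = ↔Fin-searchable A↔Fin

      _≟ʷ_ : DecidableEquality (Word A)
      _≟ʷ_ = ≡-dec _≟ᴬ_

      Admissible : ℕ → Word A → Word A → Word A → Word A → Set
      Admissible k u v u′ v′ = Side u × Side u′ × (length u + length v) + (length u′ + length v′) ≤ k

      admissible? : ∀ k u v u′ v′ → Dec (Admissible k u v u′ v′)
      admissible? k u v u′ v′ = side? u ×-dec side? u′ ×-dec (length u + length v) + (length u′ + length v′) ≤? k

      Bounded : ℕ → (Word A → Word A → Word A → Word A → Set) → Set
      Bounded k P = ∃ λ u → length u ≤ k × ∃ λ v → length v ≤ k ×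
                    ∃ λ u′ → length u′ ≤ k × ∃ λ v′ → length v′ ≤ k × P u v u′ v′

      bounded : ∀ {k P} u v u′ v′ → (length u + length v) + (length u′ + length v′) ≤ k →
                P u v u′ v′ → Bounded k P
      bounded u v u′ v′ b p =
        u , ≤-trans (m≤m+n _ _) left , v , ≤-trans (m≤n+m _ (length u)) left ,
        u′ , ≤-trans (m≤m+n _ _) right , v′ , ≤-trans (m≤n+m _ (length u′)) right , p
        where
        left  = m+n≤o⇒m≤o (length u + length v) b
        right = m+n≤o⇒n≤o (length u + length v) b

    -- There are finitely many quadruples of margins within the bound, and for each of them the
    -- suitable `f` form a regular set that can be tested for emptiness.
    near-distinct? : ∀ k → Dec (∃₂ λ x y → X x × X y × Near k x y × x ≢ y)
    near-distinct? k = map′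
      (λ { (u , _ , v , _ , u′ , _ , v′ , _ , (s , s′ , b) , f , (x∈ , y∈) , x≢y) →
           u ++ f ++ v , u′ ++ f ++ v′ , x∈ , y∈ , near f u v u′ v′ s s′ b refl refl , x≢y })
      (λ { (_ , _ , x∈ , y∈ , near f u v u′ v′ s s′ b refl refl , x≢y) →
           bounded u v u′ v′ b ((s , s′ , b) , f , (x∈ , y∈) , x≢y) })
      (anyUpTo? any k λ u → anyUpTo? any k λ v → anyUpTo? any k λ u′ → anyUpTo? any k λ v′ →
        admissible? k u v u′ v′ ×-dec
        nonempty? any (regular-∩ (regular-∩ (regular-quotient R u v) (regular-quotient R u′ v′))
                                 (regular-∁ (regular-equation A↔Fin _≟ᴬ_ u v u′ v′))))

    regular-neighbourhood : ∀ k → Regular (image (ReflClosure (Near k)) X)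
    regular-neighbourhood k = regular-ext
      (λ { (u , _ , v , _ , u′ , _ , v′ , _ , (s , s′ , b) , _ , _ , refl , refl , f , _ , refl , x∈ , refl) →
           u ++ f ++ v , x∈ , related (near f u v u′ v′ s s′ b refl refl) })
      (λ { (x , x∈ , refl) → from x∈ near-refl ; (x , x∈ , related n) → from x∈ n })
      (regular-⋃≤ A↔Fin k λ u → regular-⋃≤ A↔Fin k λ v → regular-⋃≤ A↔Fin k λ u′ → regular-⋃≤ A↔Fin k λ v′ →
        regular-∩ (regular-const (admissible? k u v u′ v′))
          (regular-cat (regular-word _≟ᴬ_ u′) (regular-cat (regular-quotient R u v) (regular-word _≟ᴬ_ v′))))
      where
      from : ∀ {x y} → X x → Near k x y → Bounded k λ u v u′ v′ → Admissible k u v u′ v′ ×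
             ∃₂ λ s t → y ≡ s ++ t × (s ≡ u′ × ∃₂ λ f p → t ≡ f ++ p × (X (u ++ f ++ v) × p ≡ v′))
      from x∈ (near f u v u′ v′ s s′ b refl refl) =
        bounded u v u′ v′ b ((s , s′ , b) , u′ , f ++ v′ , refl , refl , f , v′ , refl , x∈ , refl)

  module _ (any : Searchable A) {Common : Word A → Word A → Word A → Set}
    (common? : ∀ x y → Decidable (Common x y))
    (common⁺ : ∀ {u v u′ v′} f → Side u → Side u′ → Common (u ++ f ++ v) (u′ ++ f ++ v′) f)
    (common⁻ : ∀ {x y f} → Common x y f → ∃₂ λ u v → ∃₂ λ u′ v′ →
               Side u × Side u′ × x ≡ u ++ f ++ v × y ≡ u′ ++ f ++ v′)
    where

    private
      defect : ∀ (f u v u′ v′ : Word A) →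
               length (u ++ f ++ v) + length (u′ ++ f ++ v′) ∸ 2 * length f ≡
               (length u + length v) + (length u′ + length v′)
      defect f u v u′ v′ = trans
        (cong (_∸ 2 * length f) (trans (cong₂ _+_ (lengths u v) (lengths u′ v′))
          (rearrange (length u) (length f) (length v) (length u′) (length v′))))
        (m+n∸m≡n (2 * length f) _)
        where
        lengths : ∀ u v → length (u ++ f ++ v) ≡ length u + (length f + length v)
        lengths u v = trans (length-++ u) (cong (length u +_) (length-++ f))
        rearrange : ∀ u f v s t → (u + (f + v)) + (s + (f + t)) ≡ 2 * f + ((u + v) + (s + t))
        rearrange = solve-∀

      common-length : ∀ {x y} f → Common x y f → length f ≤ length x
      common-length f c with common⁻ c
      ... | u , _ , _ , _ , _ , _ , refl , _ = ≤-trans (length-++-≤ˡ f) (length-++-≤ʳ _ {u})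

    longest⇒near : ∀ {k x y} → (∃ λ f → IsLongest (Common x y) f × length x + length y ∸ 2 * length f ≤ k) → Near k x y
    longest⇒near (f , (c , _) , b) with common⁻ c
    ... | u , v , u′ , v′ , s , s′ , refl , refl =
      near f u v u′ v′ s s′ (≤-trans (≤-reflexive (sym (defect f u v u′ v′))) b) refl refl

    near⇒longest : ∀ {k x y} → Near k x y → ∃ λ f → IsLongest (Common x y) f × length x + length y ∸ 2 * length f ≤ k
    near⇒longest {x = x} {y} (near f u v u′ v′ s s′ b refl refl)
      with longest any (common? x y) (f , common⁺ f s s′) (length x) (λ f → common-length f)
    ... | g , g-longest@(_ , maximal) =
      g , g-longest , ≤-trans (∸-monoʳ-≤ (length x + length y) (*-monoʳ-≤ 2 (maximal f (common⁺ f s s′))))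
                              (≤-trans (≤-reflexive (defect f u v u′ v′)) b)

module Prefixes {A : Set} (_≟ᴬ_ : DecidableEquality A) where

  private
    []-++⁺ : ∀ {u v : Word A} → u ≡ [] → v ≡ [] → u ++ v ≡ []
    []-++⁺ refl refl = refl

    []-++⁻ : ∀ (u : Word A) {v} → u ++ v ≡ [] → u ≡ [] × v ≡ []
    []-++⁻ u {v} e = ++-conicalˡ u v e , ++-conicalʳ u v e

  open Nearness {A} (_≡ []) (member? regular-[]) refl []-++⁺ []-++⁻ public

  commonPrefix? : ∀ x y → Decidable (CommonPrefix {A} x y)
  commonPrefix? x y f = prefix? _≟ᴬ_ f x ×-dec prefix? _≟ᴬ_ f y

  commonPrefix⁺ : ∀ {u v u′ v′ : Word A} f → u ≡ [] → u′ ≡ [] → CommonPrefix (u ++ f ++ v) (u′ ++ f ++ v′) f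
  commonPrefix⁺ f refl refl = prefix _ , prefix _
    where
    prefix : ∀ v → Prefix _≡_ f (f ++ v)
    prefix v = Prefix.fromView (≡⇒Pointwise-≡ refl Prefix.++ v)

  commonPrefix⁻ : ∀ {x y f : Word A} → CommonPrefix x y f → ∃₂ λ u v → ∃₂ λ u′ v′ →
                  u ≡ [] × u′ ≡ [] × x ≡ u ++ f ++ v × y ≡ u′ ++ f ++ v′
  commonPrefix⁻ (p , q) with Prefix.toView p | Prefix.toView q
  ... | e Prefix.++ v | e′ Prefix.++ v′ =
    [] , v , [] , v′ , refl , refl ,
    cong (_++ v) (sym (Pointwise-≡⇒≡ e)) , cong (_++ v′) (sym (Pointwise-≡⇒≡ e′))

module Factors {A : Set} (_≟ᴬ_ : DecidableEquality A) where

  open Nearness {A} (λ _ → ⊤) (λ _ → yes _) _ _ _ public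

  commonFactor? : ∀ x y → Decidable (CommonFactor {A} x y)
  commonFactor? x y f = infix? _≟ᴬ_ f x ×-dec infix? _≟ᴬ_ f y

  commonFactor⁺ : ∀ {u v u′ v′ : Word A} f → ⊤ → ⊤ → CommonFactor (u ++ f ++ v) (u′ ++ f ++ v′) f
  commonFactor⁺ {u} {v} {u′} {v′} f _ _ =
    Infix.fromView (MkView u (≡⇒Pointwise-≡ refl) v) , Infix.fromView (MkView u′ (≡⇒Pointwise-≡ refl) v′)

  commonFactor⁻ : ∀ {x y f : Word A} → CommonFactor x y f → ∃₂ λ u v → ∃₂ λ u′ v′ →
                  ⊤ × ⊤ × x ≡ u ++ f ++ v × y ≡ u′ ++ f ++ v′
  commonFactor⁻ (p , q) with Infix.toView p | Infix.toView q
  ... | MkView u e v | MkView u′ e′ v′ =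
    u , v , u′ , v′ , _ , _ ,
    cong (λ f → u ++ f ++ v) (sym (Pointwise-≡⇒≡ e)) , cong (λ f → u′ ++ f ++ v′) (sym (Pointwise-≡⇒≡ e′))

-- Complete codes and maximality

Factor : Word A → Word A → Set
Factor f w = ∃₂ λ l r → w ≡ l ++ f ++ r

factor-trans : {f g w : Word A} → Factor f g → Factor g w → Factor f w
factor-trans {A} {f} (l , r , refl) (l′ , r′ , refl) = l′ ++ l , r ++ r′ , assoc l′ l f r r′
  where
  assoc : ∀ (l′ l f r r′ : Word A) → l′ ++ (l ++ f ++ r) ++ r′ ≡ (l′ ++ l) ++ f ++ (r ++ r′)
  assoc l′ l f r r′ = solve (++-monoid A)

pow : Word A → ℕ → Word A
pow w zero    = []
pow w (suc n) = w ++ pow w n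

pow-+ : ∀ (w : Word A) m n → pow w (m + n) ≡ pow w m ++ pow w n
pow-+ w zero    n = refl
pow-+ w (suc m) n = trans (cong (w ++_) (pow-+ w m n)) (sym (++-assoc w (pow w m) (pow w n)))

Complete : Lang A → Set
Complete X = ∀ w → ∃₂ λ u v → Star X (u ++ w ++ v)

Uncompletable : Lang A → Lang A
Uncompletable X w = ∀ u v → ¬ Star X (u ++ w ++ v)

module _ (any : Searchable A) {X : Lang A} (S : Regular (Star X)) where
  private
    completable? : ∀ w → Dec (∃₂ λ u v → Star X (u ++ w ++ v))
    completable? w = Regular.anyWord? S any
      (λ { e (v , st) → v , respects S (Regular.++-congʳ S (w ++ v) e) st })
      (λ u → Regular.anyWord? S any
        (λ e → respects S (Regular.++-congˡ S u (Regular.++-congˡ S w e)))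
        (λ v → member? S (u ++ w ++ v)))

  -- A disjunction and not a mere decision, since the refutation of (c3) builds its new word from
  -- the uncompletable one.
  complete? : Complete X ⊎ ∃ (Uncompletable X)
  complete? with Regular.anyWord? S any
      (λ { e ¬c (u , v , st) → ¬c (u , v , respects S (Regular.factor-cong S u v (sym e)) st) })
      (¬? ∘ completable?)
  ... | yes (w , ¬c) = inj₂ (w , λ u v st → ¬c (u , v , st))
  ... | no ¬∃        = inj₁ λ w → decidable-stable (completable? w) λ ¬c → ¬∃ (w , ¬c)

-- The minimal ideal of a finite quotient of the free monoid

module _ (C : Congruence A) where
  open Congruence C using (_≈_; class; size; ++-congˡ; ++-congʳ; factor-cong; anyWord?)

  period : ∀ w → ∃₂ λ i d → pow w i ≈ pow w (i + suc d)
  period w with pigeonhole (n<1+n size) (λ i → class (pow w (toℕ i)))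
  ... | i , j , i<j , e with m≤n⇒∃[o]m+o≡n i<j
  ... | d , i+d≡j = toℕ i , d , trans e (cong (class ∘ pow w) (sym (trans (+-suc (toℕ i) d) i+d≡j)))

  -- The class of `x` lies in every two-sided ideal of the quotient, hence in the least one.
  Universal : Lang A
  Universal x = ∀ w → ∃₂ λ p q → x ≈ p ++ w ++ q

  universal-factor : ∀ {x y} → Universal x → Factor x y → Universal y
  universal-factor {x} uni (l , r , refl) w =
    let p , q , e = uni w in l ++ p , q ++ r ,
      trans (factor-cong l r e) (cong class (assoc l p w q r))
    where
    assoc : ∀ (l p w q r : Word A) → l ++ (p ++ w ++ q) ++ r ≡ (l ++ p) ++ w ++ (q ++ r)
    assoc l p w q r = solve (++-monoid A)

  universal : Searchable A → ∃ Universal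
  -- A product of one representative from each class has an equivalent of every word among its
  -- factors; values that are not classes of any word contribute the empty word.
  universal any = concat (tabulate pick) , λ w →
    let ys , zs , e = ∈-∃++ (∈-tabulate⁺ {f = pick} (class w))
    in concat ys , concat zs ,
       trans (cong class (trans (cong concat e) (sym (concat-++ ys (pick (class w) ∷ zs)))))
             (factor-cong (concat ys) (concat zs) (pick-class w))
    where
    attained? : ∀ c → Dec (∃ λ w → class w ≡ c)
    attained? c = anyWord? any (λ e → trans (sym e)) (λ w → class w Fin.≟ c)
    pick : Fin size → Word A
    pick c with attained? c
    ... | yes (w , _) = w
    ... | no _        = []
    pick-class : ∀ w → pick (class w) ≈ w
    pick-class w with attained? (class w)
    ... | yes (_ , e) = e
    ... | no ¬∃       = contradiction (w , refl) ¬∃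

  -- In the finite monoid M = A*/≈ the class of x lies in the minimal ideal, where x M = x t M.
  absorb : ∀ {x} → Universal x → ∀ t → ∃ λ r → x ≈ x ++ t ++ r
  absorb {x} uni t with uni (x ++ t)
  ... | p , q , e with period (t ++ q)
  ... | i , d , per with iterate i
    where
    -- Repeating x ≈ p x (tq) pushes the power of tq up to where it is periodic. A full period can
    -- then be appended, and folding p′ x (tq)ⁱ back into x gives x ≈ x (tq)ᵈ⁺¹.
    iterate : ∀ n → ∃ λ p′ → x ≈ p′ ++ x ++ pow (t ++ q) n
    iterate zero    = [] , cong class (sym (++-identityʳ x))
    iterate (suc n) = let p′ , e′ = iterate n in p′ ++ p ,
      trans e′ (trans (factor-cong p′ (pow (t ++ q) n) e) (cong class (assoc p′ p x t q (pow (t ++ q) n))))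
      where
      assoc : ∀ (p′ p x t q z : Word A) → p′ ++ (p ++ (x ++ t) ++ q) ++ z ≡ (p′ ++ p) ++ x ++ ((t ++ q) ++ z)
      assoc p′ p x t q z = solve (++-monoid A)
  ... | p′ , e′ = q ++ pow (t ++ q) d , (begin
    class x                                                   ≡⟨ e′ ⟩
    class (p′ ++ x ++ pow (t ++ q) i)                         ≡⟨ ++-congˡ p′ (++-congˡ x per) ⟩
    class (p′ ++ x ++ pow (t ++ q) (i + suc d))               ≡⟨ cong (λ z → class (p′ ++ x ++ z)) (pow-+ (t ++ q) i (suc d)) ⟩
    class (p′ ++ x ++ pow (t ++ q) i ++ pow (t ++ q) (suc d)) ≡⟨ cong class (assoc p′ x (pow (t ++ q) i) (pow (t ++ q) (suc d))) ⟩
    class ((p′ ++ x ++ pow (t ++ q) i) ++ pow (t ++ q) (suc d)) ≡⟨ ++-congʳ (pow (t ++ q) (suc d)) (sym e′) ⟩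
    class (x ++ pow (t ++ q) (suc d))                         ≡⟨ cong (λ z → class (x ++ z)) (++-assoc t q (pow (t ++ q) d)) ⟩
    class (x ++ t ++ q ++ pow (t ++ q) d)                     ∎)
    where
    open ≡-Reasoning
    assoc : ∀ (a b c d : Word A) → a ++ b ++ c ++ d ≡ (a ++ b ++ c) ++ d
    assoc a b c d = solve (++-monoid A)

  -- With z = xyx, the word zⁱx begins with x, so `absorb` yields x ≈ zⁱ x r. For i in the periodic
  -- range of the powers of z, a further factor zᵈ⁺¹ on the left changes nothing.
  pow-absorbed : ∀ {x} → Universal x → ∀ y → ∃ λ d → pow (x ++ y ++ x) (suc d) ++ x ≈ x
  pow-absorbed {x} uni y with period z
    where z = x ++ y ++ x
  ... | i , d , per = d , (begin
    class (pow z (suc d) ++ x)                        ≡⟨ ++-congˡ (pow z (suc d)) x≈zⁱxr ⟩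
    class (pow z (suc d) ++ pow z i ++ x ++ r)        ≡⟨ cong class (++-assoc (pow z (suc d)) (pow z i) (x ++ r)) ⟨
    class ((pow z (suc d) ++ pow z i) ++ x ++ r)      ≡⟨ ++-congʳ (x ++ r) powers ⟩
    class (pow z i ++ x ++ r)                         ≡⟨ x≈zⁱxr ⟨
    class x                                           ∎)
    where
    open ≡-Reasoning
    z = x ++ y ++ x
    tail : ∀ i → ∃ λ t → pow z i ++ x ≡ x ++ t
    tail zero    = [] , sym (++-identityʳ x)
    tail (suc i) = y ++ x ++ pow z i ++ x , assoc x y (pow z i)
      where
      assoc : ∀ (x y p : Word A) → ((x ++ y ++ x) ++ p) ++ x ≡ x ++ (y ++ x ++ p ++ x)
      assoc x y p = solve (++-monoid A)
    r : Word A
    r = proj₁ (absorb uni (proj₁ (tail i)))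
    x≈zⁱxr : x ≈ pow z i ++ x ++ r
    x≈zⁱxr = trans (proj₂ (absorb uni (proj₁ (tail i)))) (cong class
      (trans (sym (++-assoc x _ r)) (trans (cong (_++ r) (sym (proj₂ (tail i)))) (++-assoc (pow z i) x r))))
    powers : pow z (suc d) ++ pow z i ≈ pow z i
    powers = trans (cong class (trans (sym (pow-+ z (suc d) i)) (cong (pow z) (+-comm (suc d) i)))) (sym per)

-- The word has one factorization over X and another one over Y in which `y` appears. Both are
-- factorizations over the code Y, hence equal, and `y` is among the factors from X. The exponent
-- `suc d` guarantees that `y` appears.
star-pow-member : ∀ {X Y : Lang A} {y} d → IsCode Y → (∀ {w} → X w → Y w) → Y y → ∀ xs → All X xs →
                  Star X (pow (concat xs ++ y ++ concat xs) (suc d) ++ concat xs) → X y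
star-pow-member {A} {X} {Y} {y} d code X⊆Y y∈Y xs xsX (zs , zsX , zs≡) =
  All.head (++⁻ʳ xs (subst (All X) zs≡block zsX))
  where
  powers : ∀ n → List (Word A)
  powers zero    = xs
  powers (suc n) = xs ++ y ∷ xs ++ powers n
  xsY : All Y xs
  xsY = All.map X⊆Y xsX
  powersY : ∀ n → All Y (powers n)
  powersY zero    = xsY
  powersY (suc n) = ++⁺ xsY (y∈Y ∷ ++⁺ xsY (powersY n))
  concat-powers : ∀ n → concat (powers n) ≡ pow (concat xs ++ y ++ concat xs) n ++ concat xs
  concat-powers zero    = refl
  concat-powers (suc n) = begin
    concat (xs ++ y ∷ xs ++ powers n)                            ≡⟨ concat-++ xs (y ∷ xs ++ powers n) ⟨
    x ++ y ++ concat (xs ++ powers n)                            ≡⟨ cong (λ w → x ++ y ++ w) (concat-++ xs (powers n)) ⟨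
    x ++ y ++ x ++ concat (powers n)                             ≡⟨ cong (λ w → x ++ y ++ x ++ w) (concat-powers n) ⟩
    x ++ y ++ x ++ pow (x ++ y ++ x) n ++ x                      ≡⟨ assoc x y (pow (x ++ y ++ x) n) ⟩
    ((x ++ y ++ x) ++ pow (x ++ y ++ x) n) ++ x                  ∎
    where
    open ≡-Reasoning
    x = concat xs
    assoc : ∀ (x y p : Word A) → x ++ y ++ x ++ p ++ x ≡ ((x ++ y ++ x) ++ p) ++ x
    assoc x y p = solve (++-monoid A)
  zs≡block : zs ≡ powers (suc d)
  zs≡block = code zs (powers (suc d)) (All.map X⊆Y zsX) (powersY (suc d)) (trans zs≡ (sym (concat-powers (suc d))))

-- A universal word completed to an element of X* is still universal, which supplies the x of the
-- argument. Only X* has to be saturated, so Y may be any code.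
complete⇒maximal : Searchable A → {X Y : Lang A} → Regular (Star X) → Complete X →
                   IsCode Y → (∀ {w} → X w → Y w) → ∀ {w} → Y w → X w
complete⇒maximal any {X} S complete code X⊆Y {y} y∈Y =
  let j , j-universal     = universal (congruence S) any
      u , v , xs , xsX , e = complete j
      d , absorbed        = pow-absorbed (congruence S) (universal-factor (congruence S) j-universal (u , v , e)) y
  in star-pow-member d code X⊆Y y∈Y xs xsX (respects S (sym absorbed) (xs , xsX , refl))

-- Unbordered words and the enlargement of incomplete codes

Unbordered : Word A → Set
Unbordered z = ∀ p s q → p ++ s ≡ z → s ++ q ≡ z → p ≡ [] ⊎ s ≡ []

infix-head-[] : ∀ (r f s : Word A) → f ≡ r ++ f ++ s → r ≡ []
infix-head-[] []      f s _ = refl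
infix-head-[] (c ∷ r) f s e = contradiction (cong length e) (<⇒≢ (begin-strict
  length f                   <⟨ s≤s (≤-trans (length-++-≤ˡ f) (length-++-≤ʳ (f ++ s) {r})) ⟩
  length (c ∷ r ++ f ++ s)   ∎))
  where open ≤-Reasoning

module Adjoin {X : Lang A} (code : IsCode X) {z : Word A} (unbordered : Unbordered z) (uncompletable : Uncompletable X z) where

  Adjoined : Lang A
  Adjoined w = X w ⊎ w ≡ z

  private
    first-z : ∀ xs → All Adjoined xs → All X xs ⊎
              ∃₂ λ us vs → xs ≡ us ++ z ∷ vs × All X us × All Adjoined vs
    first-z [] [] = inj₁ []
    first-z (_ ∷ xs) (inj₂ refl ∷ as) = inj₂ ([] , xs , refl , [] , as)
    first-z (x ∷ xs) (inj₁ x∈ ∷ as) with first-z xs as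
    ... | inj₁ all = inj₁ (x∈ ∷ all)
    ... | inj₂ (us , vs , refl , usX , vsA) = inj₂ (x ∷ us , vs , refl , x∈ ∷ usX , vsA)

    no-z : ∀ us vs ys → All X ys → concat (us ++ z ∷ vs) ≢ concat ys
    no-z us vs ys ysX e =
      uncompletable (concat us) (concat vs) (ys , ysX , trans (sym e) (sym (concat-++ us (z ∷ vs))))

    -- Applied to the first `z` in each of two factorizations, `t` being the offset between them. If
    -- the earlier `z` fits into `t`, it is a factor of a word of X*; if the two overlap properly,
    -- `z` has a border. Only offset zero remains.
    align : ∀ u t {v v′} → Star X (u ++ t) → z ++ v ≡ t ++ z ++ v′ → t ≡ []
    align u t {v} {v′} st e with ++-split z t e
    ... | inj₂ (r , refl , _) = contradiction st (uncompletable u r)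
    ... | inj₁ (s , z≡ , e′) with ++-split z s e′
    ...   | inj₂ (q , refl , _) = infix-head-[] t z q z≡
    ...   | inj₁ (q , z≡′ , _) with unbordered t s q (sym z≡) (sym z≡′)
    ...     | inj₁ t≡[] = t≡[]
    ...     | inj₂ refl = contradiction (subst (λ t → Star X (u ++ t)) (sym (++-identityʳ t)) st)
                            (subst (λ w → ¬ Star X (u ++ w)) (trans (++-identityʳ z) z≡) (uncompletable u []))

  adjoined-code : IsCode Adjoined
  adjoined-code xs ys = go (length xs) xs ys ≤-refl
    where
    go : ∀ n xs ys → length xs ≤ n → All Adjoined xs → All Adjoined ys → concat xs ≡ concat ys → xs ≡ ys
    go n xs ys l xsA ysA e with first-z xs xsA | first-z ys ysA
    ... | inj₁ xsX | inj₁ ysX = code xs ys xsX ysX e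
    ... | inj₁ xsX | inj₂ (us , vs , refl , _) = contradiction (sym e) (no-z us vs xs xsX)
    ... | inj₂ (us , vs , refl , _) | inj₁ ysX = contradiction e (no-z us vs ys ysX)
    go zero    xs ys l xsA ysA e | inj₂ ([] , vs , refl , _) | inj₂ _ = contradiction l λ ()
    go zero    xs ys l xsA ysA e | inj₂ (_ ∷ us , vs , refl , _) | inj₂ _ = contradiction l λ ()
    go (suc n) xs ys l xsA ysA e | inj₂ (us , vs , refl , usX , vsA) | inj₂ (us′ , vs′ , refl , us′X , vs′A) =
      cong₂ (λ us vs → us ++ z ∷ vs) us≡us′ (go n vs vs′ shorter vsA vs′A vs≡vs′)
      where
      shorter : length vs ≤ n
      shorter = s≤s⁻¹ (≤-trans (length-++-≤ʳ (z ∷ vs) {us}) l)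
      e′ : concat us ++ z ++ concat vs ≡ concat us′ ++ z ++ concat vs′
      e′ = trans (concat-++ us (z ∷ vs)) (trans e (sym (concat-++ us′ (z ∷ vs′))))
      concat-us : concat us ≡ concat us′
      concat-us with ++-split (concat us) (concat us′) e′
      ... | inj₁ (t , p , q) with align (concat us′) t (us , usX , p) q
      ...   | refl = trans p (++-identityʳ (concat us′))
      concat-us | inj₂ (t , p , q) with align (concat us) t (us′ , us′X , p) q
      ...   | refl = sym (trans p (++-identityʳ (concat us)))
      us≡us′ : us ≡ us′
      us≡us′ = code us us′ usX us′X concat-us
      vs≡vs′ : concat vs ≡ concat vs′
      vs≡vs′ = ++-cancelˡ z _ _ (++-cancelˡ (concat us) _ _
                 (trans e′ (cong (_++ z ++ concat vs′) (sym concat-us))))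

module _ {a b : A} (a≢b : a ≢ b) (W : Word A) (N : ℕ) where

  private
    bs : Word A
    bs = replicate N b

    all-b : All (_≡ b) bs
    all-b = replicate⁺ N refl

    no-a : ∀ p {s} → bs ≢ p ++ a ∷ s
    no-a p e = a≢b (All.head (++⁻ʳ p (subst (All (_≡ b)) e all-b)))

    |bs|≡N : length bs ≡ N
    |bs|≡N = length-replicate N

    misaligned : ∀ u s q → length (a ∷ W) ≤ N → length u < length (a ∷ W) →
                 a ∷ s ≡ u ++ a ∷ bs → (a ∷ s) ++ q ≢ (a ∷ W) ++ a ∷ bs
    misaligned u s q |aW|≤N |u|<|aW| s≡ sq
      with ++-split u (a ∷ W) (trans (sym (++-assoc u (a ∷ bs) q)) (trans (cong (_++ q) (sym s≡)) sq))
    ... | inj₁ (r , refl , _) = contradiction (length-++-≤ˡ (a ∷ W) {r}) (<⇒≱ |u|<|aW|)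
    ... | inj₂ ([] , aW≡ , _) =
      contradiction (sym (cong length (trans aW≡ (++-identityʳ u)))) (<⇒≢ |u|<|aW|)
    ... | inj₂ (x ∷ r , aW≡ , e) = contradiction
      (≤-trans (≤-reflexive (sym |bs|≡N)) (bs≤r (++-split bs r (∷-injectiveʳ e)))) (<⇒≱ (≤-trans r<aW |aW|≤N))
      where
      r<aW : length r < length (a ∷ W)
      r<aW = ≤-trans (length-++-≤ʳ (x ∷ r) {u}) (≤-reflexive (cong length (sym aW≡)))
      bs≤r : (∃ λ t → bs ≡ r ++ t × a ∷ bs ≡ t ++ q) ⊎ (∃ λ t → r ≡ bs ++ t × q ≡ t ++ a ∷ bs) →
             length bs ≤ length r
      bs≤r (inj₁ ([] , bs≡ , _)) = ≤-reflexive (cong length (trans bs≡ (++-identityʳ r)))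
      bs≤r (inj₁ (_ ∷ t , bs≡ , e)) = contradiction bs≡ (subst (λ x → bs ≢ r ++ x ∷ t) (∷-injectiveˡ e) (no-a r))
      bs≤r (inj₂ (t , refl , _)) = length-++-≤ˡ bs

  -- A proper nonempty border starts with `a`, so as a suffix it cannot start among the final
  -- letters `b`: it ends in `a ∷ bs`, preceded by fewer than `length (a ∷ W)` letters. Read as a
  -- prefix, its block of `N` letters `b` would cover the `a` that follows `a ∷ W`.
  unbordered-padding : length (a ∷ W) ≤ N → Unbordered ((a ∷ W) ++ [ a ] ++ bs)
  unbordered-padding |aW|≤N []       s       q ps sq = inj₁ refl
  unbordered-padding |aW|≤N (c ∷ p) []      q ps sq = inj₂ refl
  unbordered-padding |aW|≤N (c ∷ p) (d ∷ s) q ps sq with ∷-injectiveˡ sq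
  ... | refl with ++-split (a ∷ W) (c ∷ p) (sym ps)
  ... | inj₂ ([] , p≡ , bs≡) = contradiction sq (misaligned [] s q |aW|≤N (s≤s z≤n) (sym bs≡))
  ... | inj₂ (x ∷ r , p≡ , bs≡) = contradiction (∷-injectiveʳ bs≡) (no-a r)
  ... | inj₁ (u , aW≡ , s≡) = contradiction sq (misaligned u s q |aW|≤N u<aW s≡)
    where
    u<aW : length u < length (a ∷ W)
    u<aW = ≤-trans (s≤s (length-++-≤ʳ u {p})) (≤-reflexive (cong length (sym aW≡)))

module _ {a b : A} (a≢b : a ≢ b) {τ : WordRel A} {X : Lang A} {w₀ w₁ : Word A}
  (uncompletable : Uncompletable X w₀) (w₀⊑w₁ : Factor w₀ w₁) (k : ℕ)
  (unrelated : ∀ l r x → k ≤ length l → k ≤ length r → X x →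
               ¬ τ x (l ++ w₁ ++ r) × ¬ τ (l ++ w₁ ++ r) x)
  where

  -- Maximality would put `z` into X although `z` is uncompletable.
  uncompletable⇒¬C3 : ¬ C3 τ X
  uncompletable⇒¬C3 ((code , indep) , maximal) =
    z-uncompletable [] []
      (z ∷ [] , maximal Adjoined (adjoined-code , independent) inj₁ (inj₂ refl) ∷ [] , refl)
    where
    l W r z : Word A
    l = replicate k a
    W = l ++ w₁
    -- The summand `length (a ∷ W)` makes `z` unbordered; `k` makes the right padding long enough
    -- for `unrelated`.
    r = [ a ] ++ replicate (length (a ∷ W) + k) b
    z = (a ∷ W) ++ r

    z≡ : z ≡ (a ∷ l) ++ w₁ ++ r
    z≡ = ++-assoc (a ∷ l) w₁ r

    z-uncompletable : Uncompletable X z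
    z-uncompletable u v st with factor-trans (factor-trans w₀⊑w₁ (a ∷ l , r , z≡)) (u , v , refl)
    ... | u′ , v′ , e = uncompletable u′ v′ (subst (Star X) e st)

    open Adjoin code (unbordered-padding a≢b W (length (a ∷ W) + k) (m≤m+n _ k)) z-uncompletable

    z-unrelated : ∀ {x} → X x → ¬ τ x z × ¬ τ z x
    z-unrelated {x} x∈ = subst (λ z → ¬ τ x z × ¬ τ z x) (sym z≡)
      (unrelated (a ∷ l) r x
        (m≤n⇒m≤1+n (≤-reflexive (sym (length-replicate k))))
        (m≤n⇒m≤1+n (≤-trans (m≤n+m k (length (a ∷ W))) (≤-reflexive (sym (length-replicate (length (a ∷ W) + k)))))) x∈)

    independent : Independent (antiReflexive τ) Adjoined
    independent y ((x , inj₁ x∈ , τxy , x≢y) , inj₁ y∈) = indep y ((x , x∈ , τxy , x≢y) , y∈)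
    independent y ((x , inj₁ x∈ , τxy , x≢y) , inj₂ refl) = proj₁ (z-unrelated x∈) τxy
    independent y ((x , inj₂ refl , τxy , x≢y) , inj₁ y∈) = proj₂ (z-unrelated y∈) τxy
    independent y ((x , inj₂ refl , τxy , x≢y) , inj₂ refl) = x≢y refl

-- Automorphisms and anti-automorphisms

-- The two conditions say that the truth value of `P` turns concatenation into conjunction, so two
-- classes suffice.
regular-multiplicative : {P : Lang A} → Decidable P → (∀ u v → P (u ++ v) → P u × P v) →
                         (∀ u v → P u → P v → P (u ++ v)) → Regular P
regular-multiplicative {P = P} P? split join = record
  { congruence = record
    { size = 2
    ; class = λ w → decToFin (P? w)
    ; ++-congruent = λ {u} {u′} {v} {v′} p q → decToFin-cong (P? (u ++ v)) (P? (u′ ++ v′))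
        (λ uv → let pu , pv = split u v uv in
           join u′ v′ (decToFin-transport (P? u) (P? u′) p pu) (decToFin-transport (P? v) (P? v′) q pv))
        (λ uv → let pu , pv = split u′ v′ uv in
           join u v (decToFin-transport (P? u′) (P? u) (sym p) pu) (decToFin-transport (P? v′) (P? v) (sym q) pv))
    }
  ; respects = λ {u} {v} e → decToFin-transport (P? u) (P? v) e
  ; member?  = P?
  }

++-injective : ∀ (u u′ : Word A) {v v′} → length u ≡ length u′ → u ++ v ≡ u′ ++ v′ → u ≡ u′ × v ≡ v′
++-injective []      []        _   e = refl , e
++-injective (a ∷ u) (a′ ∷ u′) len e with ∷-injective e
... | refl , e′ with ++-injective u u′ (suc-injective len) e′
...   | refl , v≡ = refl , v≡

Multiplicative AntiMultiplicative Morphic : (Word A → Word A) → Set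
Multiplicative f     = ∀ u v → f (u ++ v) ≡ f u ++ f v
AntiMultiplicative f = ∀ u v → f (u ++ v) ≡ f v ++ f u
Morphic f            = Multiplicative f ⊎ AntiMultiplicative f

module _ {f : Word A → Word A} where

  morphic-[] : Morphic f → f [] ≡ []
  morphic-[] (inj₁ h) = ++-identityʳ-unique (f []) (h [] [])
  morphic-[] (inj₂ h) = ++-identityʳ-unique (f []) (h [] [])

  morphic-length-++ : Morphic f → ∀ u v → length (f (u ++ v)) ≡ length (f u) + length (f v)
  morphic-length-++ (inj₁ h) u v = trans (cong length (h u v)) (length-++ (f u))
  morphic-length-++ (inj₂ h) u v =
    trans (cong length (h u v)) (trans (length-++-comm (f v) (f u)) (length-++ (f u)))

  morphic-nondecreasing : Morphic f → Injective _≡_ _≡_ f → ∀ w → length w ≤ length (f w)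
  morphic-nondecreasing m inj []      = z≤n
  morphic-nondecreasing m inj (a ∷ w) =
    ≤-trans (+-mono-≤ letter (morphic-nondecreasing m inj w))
            (≤-reflexive (sym (morphic-length-++ m [ a ] w)))
    where
    letter : 1 ≤ length (f [ a ])
    letter with f [ a ] in e
    ... | _ ∷ _ = s≤s z≤n
    ... | []    with inj (trans e (sym (morphic-[] m)))
    ...   | ()

  morphic-factor : Morphic f → ∀ {u w} → Factor u w → Factor (f u) (f w)
  morphic-factor (inj₁ h) {u} (l , r , refl) =
    f l , f r , trans (h l (u ++ r)) (cong (f l ++_) (h u r))
  morphic-factor (inj₂ h) {u} (l , r , refl) =
    f r , f l , trans (h l (u ++ r)) (trans (cong (_++ f l) (h u r)) (++-assoc (f r) (f u) (f l)))

  -- An anti-multiplicative `f` merely exchanges the two arguments of the congruence, which a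
  -- two-sided congruence tolerates.
  regular-preimage : Morphic f → {X : Lang A} → Regular X → Regular (X ∘ f)
  regular-preimage m R = record
    { congruence = record { size = R.size ; class = R.class ∘ f ; ++-congruent = congruent m }
    ; respects   = R.respects
    ; member?    = R.member? ∘ f
    }
    where
    module R = Regular R
    congruent : Morphic f → ∀ {u u′ v v′} → f u R.≈ f u′ → f v R.≈ f v′ → f (u ++ v) R.≈ f (u′ ++ v′)
    congruent (inj₁ h) {u} {u′} {v} {v′} p q =
      trans (cong R.class (h u v)) (trans (R.++-congruent p q) (cong R.class (sym (h u′ v′))))
    congruent (inj₂ h) {u} {u′} {v} {v′} p q =
      trans (cong R.class (h u v)) (trans (R.++-congruent q p) (cong R.class (sym (h u′ v′))))

record Symmetry (θ : Word A → Word A) : Set where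
  field
    θ⁻¹      : Word A → Word A
    inverseˡ : ∀ w → θ (θ⁻¹ w) ≡ w
    inverseʳ : ∀ w → θ⁻¹ (θ w) ≡ w
    morphic  : Morphic θ

  injective : Injective _≡_ _≡_ θ
  injective e = trans (sym (inverseʳ _)) (trans (cong θ⁻¹ e) (inverseʳ _))

  morphic⁻¹ : Morphic θ⁻¹
  morphic⁻¹ with morphic
  ... | inj₁ h = inj₁ λ u v → injective (trans (inverseˡ _)
                   (sym (trans (h (θ⁻¹ u) (θ⁻¹ v)) (cong₂ _++_ (inverseˡ u) (inverseˡ v)))))
  ... | inj₂ h = inj₂ λ u v → injective (trans (inverseˡ _)
                   (sym (trans (h (θ⁻¹ v) (θ⁻¹ u)) (cong₂ _++_ (inverseˡ u) (inverseˡ v)))))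

  length-preserving : ∀ w → length (θ w) ≡ length w
  length-preserving w = ≤-antisym
    (≤-trans (morphic-nondecreasing morphic⁻¹ injective⁻¹ (θ w)) (≤-reflexive (cong length (inverseʳ w))))
    (morphic-nondecreasing morphic injective w)
    where
    injective⁻¹ : Injective _≡_ _≡_ θ⁻¹
    injective⁻¹ e = trans (sym (inverseˡ _)) (trans (cong θ e) (inverseˡ _))

symmetry : {θ : Word A → Word A} → IsAutomorphism θ ⊎ IsAntiAutomorphism θ → Symmetry θ
symmetry {A} {θ} auto = record
  { θ⁻¹      = λ w → proj₁ (surjective w)
  ; inverseˡ = λ w → proj₂ (surjective w) refl
  ; inverseʳ = λ w → proj₁ bijective (proj₂ (surjective (θ w)) refl)
  ; morphic  = morphic auto
  }
  where
  open MonoidMorphisms using (module IsMonoidIsomorphism)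
  bijection : IsAutomorphism θ ⊎ IsAntiAutomorphism θ → Bijective _≡_ _≡_ θ
  bijection (inj₁ iso) = IsMonoidIsomorphism.injective iso , IsMonoidIsomorphism.surjective iso
  bijection (inj₂ (b , _)) = b
  bijective : Bijective _≡_ _≡_ θ
  bijective = bijection auto
  surjective = proj₂ bijective
  morphic : IsAutomorphism θ ⊎ IsAntiAutomorphism θ → Morphic θ
  morphic (inj₁ iso)     = inj₁ (IsMonoidIsomorphism.homo iso)
  morphic (inj₂ (_ , h)) = inj₂ h

-- A word over A × A stands for a pair of words of equal length, the second one
-- read from right to left, so that growing the word nests the pair outside in.
left right : Word (A × A) → Word A
left = map proj₁
right []             = []
right ((_ , b) ∷ zs) = right zs ++ [ b ]

right-++ : ∀ (zs ws : Word (A × A)) → right (zs ++ ws) ≡ right ws ++ right zs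
right-++ []             ws = sym (++-identityʳ (right ws))
right-++ ((_ , b) ∷ zs) ws = trans (cong (_++ [ b ]) (right-++ zs ws)) (++-assoc (right ws) (right zs) [ b ])

length-right : ∀ (zs : Word (A × A)) → length (right zs) ≡ length (left zs)
length-right []             = refl
length-right ((_ , b) ∷ zs) = trans (length-++-comm (right zs) [ b ]) (cong suc (length-right zs))

around : Word (A × A) → Word A → Word A
around zs m = left zs ++ m ++ right zs

decompose : ∀ (w : Word A) → ∃₂ λ zs m → length m ≤ 1 × w ≡ around zs m
decompose w = go (length w) w ≤-refl
  where
  go : ∀ n w → length w ≤ n → ∃₂ λ zs m → length m ≤ 1 × w ≡ around zs m
  go n       []      _       = [] , [] , z≤n , refl
  go (suc n) (a ∷ w) (s≤s l) with initLast w
  ... | []      = [] , [ a ] , s≤s z≤n , refl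
  ... | w′ ∷ʳ′ b with go n w′ (≤-trans (length-++-≤ˡ w′) l)
  ...   | zs , m , m≤1 , w′≡ = (a , b) ∷ zs , m , m≤1 ,
          cong (a ∷_) (trans (cong (_++ [ b ]) w′≡) (assoc (left zs) m (right zs) [ b ]))
    where
    assoc : ∀ (p m s t : Word A) → (p ++ m ++ s) ++ t ≡ p ++ m ++ s ++ t
    assoc p m s t = trans (++-assoc p (m ++ s) t) (cong (p ++_) (++-assoc m s t))

regular-around : {X : Lang A} → Regular X → ∀ m → Regular (λ zs → X (around zs m))
regular-around {A} R m = record
  { congruence = record
    { size = R.size * R.size
    ; class = pair
    ; ++-congruent = λ {u} {u′} {v} {v′} p q →
        let p₁ , p₂ = unpair u u′ p ; q₁ , q₂ = unpair v v′ q in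
        cong₂ combine
          (trans (cong R.class (map-++ proj₁ u v)) (trans (R.++-congruent p₁ q₁) (cong R.class (sym (map-++ proj₁ u′ v′)))))
          (trans (cong R.class (right-++ u v)) (trans (R.++-congruent q₂ p₂) (cong R.class (sym (right-++ u′ v′)))))
    }
  ; respects = λ {u} {v} e → let e₁ , e₂ = unpair u v e in
      R.respects (R.++-congruent e₁ (R.++-congˡ m e₂))
  ; member? = λ zs → R.member? (around zs m)
  }
  where
  module R = Regular R
  pair : Word (A × A) → Fin _
  pair zs = combine (R.class (left zs)) (R.class (right zs))
  unpair : ∀ u v → pair u ≡ pair v → left u R.≈ left v × right u R.≈ right v
  unpair u v = combine-injective (R.class (left u)) (R.class (right u)) (R.class (left v)) (R.class (right v))

module _ (any : Searchable A) (_≟_ : DecidableEquality A) {θ : Word A → Word A} (sy : Symmetry θ) where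

  open Symmetry sy

  private
    _≟ʷ_ : DecidableEquality (Word A)
    _≟ʷ_ = ≡-dec _≟_

  regular-fixed : Multiplicative θ → Regular (λ w → θ w ≡ w)
  regular-fixed h = regular-multiplicative (λ w → θ w ≟ʷ w)
    (λ u v e → ++-injective (θ u) u (length-preserving u) (trans (sym (h u v)) e))
    (λ u v p q → trans (h u v) (cong₂ _++_ p q))

  module _ (h : AntiMultiplicative θ) where

    -- What fixedness says about the two outer halves, after comparing lengths in θ(left m right).
    -- Both equations are kept since θ may fail to be an involution. Unlike fixedness itself, the
    -- property is multiplicative in `zs`.
    Mirrored : Word (A × A) → Set
    Mirrored zs = θ (right zs) ≡ left zs × θ (left zs) ≡ right zs

    regular-Mirrored : Regular Mirrored
    regular-Mirrored = regular-multiplicative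
      (λ zs → (θ (right zs) ≟ʷ left zs) ×-dec (θ (left zs) ≟ʷ right zs))
      (λ { zs ws (p , q) →
        let p₁ , p₂ = ++-injective (θ (right zs)) (left zs) (trans (length-preserving (right zs)) (length-right zs))
                        (trans (sym (θ-right zs ws)) (trans p (map-++ proj₁ zs ws)))
            q₁ , q₂ = ++-injective (θ (left ws)) (right ws) (trans (length-preserving (left ws)) (sym (length-right ws)))
                        (trans (sym (θ-left zs ws)) (trans q (right-++ zs ws)))
        in (p₁ , q₂) , (p₂ , q₁) })
      (λ { zs ws (p₁ , q₁) (p₂ , q₂) →
        trans (θ-right zs ws) (trans (cong₂ _++_ p₁ p₂) (sym (map-++ proj₁ zs ws))) ,
        trans (θ-left zs ws) (trans (cong₂ _++_ q₂ q₁) (sym (right-++ zs ws))) })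
      where
      θ-right : ∀ zs ws → θ (right (zs ++ ws)) ≡ θ (right zs) ++ θ (right ws)
      θ-right zs ws = trans (cong θ (right-++ zs ws)) (h (right ws) (right zs))
      θ-left : ∀ zs ws → θ (left (zs ++ ws)) ≡ θ (left ws) ++ θ (left zs)
      θ-left zs ws = trans (cong θ (map-++ proj₁ zs ws)) (h (left zs) (left ws))

    θ-around : ∀ zs m → θ (around zs m) ≡ θ (right zs) ++ θ m ++ θ (left zs)
    θ-around zs m = trans (h (left zs) (m ++ right zs))
      (trans (cong (_++ θ (left zs)) (h m (right zs))) (++-assoc (θ (right zs)) (θ m) (θ (left zs))))

    fixed⁺ : ∀ zs m → Mirrored zs × θ m ≡ m → θ (around zs m) ≡ around zs m
    fixed⁺ zs m ((p , q) , r) = trans (θ-around zs m) (cong₂ _++_ p (cong₂ _++_ r q))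

    fixed⁻ : ∀ zs m → θ (around zs m) ≡ around zs m → Mirrored zs × θ m ≡ m
    fixed⁻ zs m e =
      let p , e′ = ++-injective (θ (right zs)) (left zs) (trans (length-preserving (right zs)) (length-right zs))
                     (trans (sym (θ-around zs m)) e)
          r , q  = ++-injective (θ m) m (length-preserving m) e′
      in (p , q) , r

  unfixed? : {X : Lang A} → Regular X → Dec (∃ λ x → (X x × X (θ x)) × θ x ≢ x)
  unfixed? {X} R = cases morphic
    where
    pairs : Regular (λ x → X x × X (θ x))
    pairs = regular-∩ R (regular-preimage morphic R)
    cases : Morphic θ → Dec (∃ λ x → (X x × X (θ x)) × θ x ≢ x)
    cases (inj₁ h) = nonempty? any (regular-∩ pairs (regular-∁ (regular-fixed h)))
    cases (inj₂ h) = map′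
      (λ { (m , _ , zs , p , ¬fixed) → around zs m , p , ¬fixed ∘ fixed⁻ h zs m })
      (λ { (x , p , x-moved) → from x p x-moved (decompose x) })
      -- `m` is the middle letter of a word of odd length, and empty for even length.
      (anyUpTo? any 1 λ m → nonempty? (×-searchable any any)
        (regular-∩ (regular-around pairs m)
                   (regular-∁ (regular-∩ (regular-Mirrored h) (regular-const (θ m ≟ʷ m))))))
      where
      from : ∀ x → X x × X (θ x) → θ x ≢ x → (∃₂ λ zs m → length m ≤ 1 × x ≡ around zs m) →
             ∃ λ m → length m ≤ 1 × ∃ λ zs → (X (around zs m) × X (θ (around zs m))) × ¬ (Mirrored h zs × θ m ≡ m)
      from _ p x-moved (zs , m , m≤1 , refl) = m , m≤1 , zs , p , x-moved ∘ fixed⁺ h zs m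

-- The four conditions

Distinct : WordRel A → Lang A → Set
Distinct τ X = ∃₂ λ x y → X x × X y × τ x y × x ≢ y

module _ {τ : WordRel A} {X : Lang A} where

  C1? : Dec (Distinct τ X) → Dec (C1 τ X)
  C1? = map′ (λ { ¬d y ((x , x∈ , τxy , x≢y) , y∈) → ¬d (x , y , x∈ , y∈ , τxy , x≢y) })
             (λ { c1 (x , y , x∈ , y∈ , τxy , x≢y) → c1 y ((x , x∈ , τxy , x≢y) , y∈) })
        ∘ ¬?

  -- `σ` stands for having a common τ-image, up to symmetry: the distance with doubled radius for 𝒫
  -- and ℱ, the relation itself for an injective θ.
  C2? : DecidableEquality (Word A) → (σ : WordRel A) →
        (∀ {x y z} → τ x z → τ y z → σ x y ⊎ σ y x) →
        (∀ {x y} → σ x y → ∃ λ z → τ x z × τ y z) →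
        Dec (Distinct σ X) → Dec (C2 τ X)
  C2? _≟_ σ join meet = map′
    (λ { ¬d {x} {y} x∈ y∈ (z , (_ , refl , τxz) , (_ , refl , τyz)) →
         decidable-stable (x ≟ y) λ x≢y → ¬d (distinct x∈ y∈ x≢y (join τxz τyz)) })
    (λ { c2 (x , y , x∈ , y∈ , σxy , x≢y) → let z , τxz , τyz = meet σxy in
         x≢y (c2 x∈ y∈ (z , (x , refl , τxz) , (y , refl , τyz))) })
    ∘ ¬?
    where
    distinct : ∀ {x y} → X x → X y → x ≢ y → σ x y ⊎ σ y x → Distinct σ X
    distinct x∈ y∈ x≢y (inj₁ s) = _ , _ , x∈ , y∈ , s , x≢y
    distinct x∈ y∈ x≢y (inj₂ s) = _ , _ , y∈ , x∈ , s , x≢y ∘ sym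

  C3? : Searchable A → IsCode X → Regular (Star X) → Dec (C1 τ X) →
        (∀ {w} → Uncompletable X w → ¬ C3 τ X) → Dec (C3 τ X)
  C3? any code S (no ¬c1) incomplete = no λ { ((_ , c1) , _) → ¬c1 c1 }
  C3? any code S (yes c1) incomplete = cases (complete? any S)
    where
    cases : Complete X ⊎ ∃ (Uncompletable X) → Dec (C3 τ X)
    cases (inj₁ complete) = yes ((code , c1) , λ Y (Y-code , _) X⊆Y → complete⇒maximal any S complete Y-code X⊆Y)
    cases (inj₂ (_ , uncompletable)) = no (incomplete uncompletable)

-- Words unrelated to the code, and the decision procedures

++-splitˡ : ∀ (u l : Word A) {x y} → length u ≤ length l → u ++ x ≡ l ++ y → ∃ λ e → l ≡ u ++ e × x ≡ e ++ y
++-splitˡ u l len e with ++-split u l e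
... | inj₂ split = split
... | inj₁ ([] , u≡ , y≡) = [] , sym (trans (++-identityʳ u) (trans u≡ (++-identityʳ l))) , sym y≡
... | inj₁ (c ∷ r , refl , _) = contradiction len (<⇒≱ (longer l))
  where
  longer : ∀ l → length l < length (l ++ c ∷ r)
  longer []      = s≤s z≤n
  longer (_ ∷ l) = s≤s (longer l)

++-splitʳ : ∀ (f g : Word A) {v r} → length v ≤ length r → f ++ v ≡ g ++ r → ∃ λ q → f ≡ g ++ q
++-splitʳ f g len e with ++-split f g e
... | inj₁ (q , f≡ , _) = q , f≡
... | inj₂ ([] , g≡ , _) = [] , sym (trans (++-identityʳ g) (trans g≡ (++-identityʳ f)))
... | inj₂ (c ∷ q , _ , refl) = contradiction len (<⇒≱ (s≤s (length-++-≤ʳ _ {q})))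

core-factor : ∀ (u f v l w r : Word A) → length u ≤ length l → length v ≤ length r →
              u ++ f ++ v ≡ l ++ w ++ r → Factor w f
core-factor u f v l w r u≤l v≤r e =
  let d , _ , e′ = ++-splitˡ u l u≤l e
      q , f≡     = ++-splitʳ f (d ++ w) v≤r (trans e′ (sym (++-assoc d w r)))
  in d , q , trans f≡ (++-assoc d w q)

star-letter : {X : Lang A} → ∀ {x} → X x → Star X x
star-letter {X = X} {x} x∈ = subst (Star X) (++-identityʳ x) (star-∷ x∈ star-[])

uncompletable-factor : {X : Lang A} {w x : Word A} → Uncompletable X w → Factor w x → ¬ X x
uncompletable-factor uncompletable (l , r , refl) x∈ = uncompletable l r (star-letter x∈)

distinct-letters : ∀ {n} → A ↔ Fin n → 2 ≤ n → ∃₂ λ (a b : A) → a ≢ b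
distinct-letters {n = suc (suc _)} A↔Fin (s≤s (s≤s _)) = from zero , from (suc zero) ,
  λ e → Fin.0≢1+n (trans (sym (strictlyInverseˡ zero)) (trans (cong to e) (strictlyInverseˡ (suc zero))))
  where open Inverse A↔Fin

module Decide {A : Set} {n : ℕ} (A↔Fin : A ↔ Fin n) (2≤n : 2 ≤ n) {X : Lang A} (R : Regular X) (code : IsCode X) where

  open Inverse A↔Fin using (to; from; strictlyInverseʳ)

  any : Searchable A
  any = ↔Fin-searchable A↔Fin

  _≟ᴬ_ : DecidableEquality A
  a ≟ᴬ b = map′ (λ e → trans (sym (strictlyInverseʳ a)) (trans (cong from e) (strictlyInverseʳ b)))
                (cong to) (to a Fin.≟ to b)

  _≟ʷ_ : DecidableEquality (Word A)
  _≟ʷ_ = ≡-dec _≟ᴬ_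

  decide : (τ σ : WordRel A) → Dec (Distinct τ X) → Dec (Distinct σ X) →
           (∀ {x y z} → τ x z → τ y z → σ x y ⊎ σ y x) →
           (∀ {x y} → σ x y → ∃ λ z → τ x z × τ y z) →
           Regular (image (ReflClosure τ) X) →
           (∀ {w} → Uncompletable X w → ∃₂ λ k w₁ → Factor w w₁ ×
             (∀ l r x → k ≤ length l → k ≤ length r → X x → ¬ τ x (l ++ w₁ ++ r) × ¬ τ (l ++ w₁ ++ r) x)) →
           EachDecidable τ X
  decide τ σ dτ dσ join meet neighbourhood unrelated =
    C1? dτ , C2? _≟ʷ_ σ join meet dσ , C3? any code (regular-star R) (C1? dτ) ¬maximal , isCode? any neighbourhood
    where
    ¬maximal : ∀ {w} → Uncompletable X w → ¬ C3 τ X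
    ¬maximal uncompletable with distinct-letters A↔Fin 2≤n | unrelated uncompletable
    ... | _ , _ , a≢b | k , w₁ , w⊑w₁ , un = uncompletable⇒¬C3 a≢b uncompletable w⊑w₁ k un

  module _ {Side : Word A → Set} (side? : ∀ u → Dec (Side u)) (side-[] : Side [])
    (side-++⁺ : ∀ {u v} → Side u → Side v → Side (u ++ v))
    (side-++⁻ : ∀ u {v} → Side (u ++ v) → Side u × Side v) where

    open Nearness Side side? side-[] side-++⁺ side-++⁻

    -- Margins of total length at most `k` cannot reach through the padding, so `w` survives inside
    -- the common factor and thus inside `x`.
    near-unrelated : ∀ {k w} → Uncompletable X w → ∀ l r x → k ≤ length l → k ≤ length r →
                     Near k (l ++ w ++ r) x → ¬ X x
    near-unrelated {w = w} uncompletable l r _ k≤l k≤r (near f u v u′ v′ _ _ b e refl) =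
      uncompletable-factor uncompletable
        (factor-trans (core-factor u f v l w r (≤-trans (≤-trans (m≤m+n _ _) b′) k≤l)
                                               (≤-trans (≤-trans (m≤n+m _ (length u)) b′) k≤r) (sym e))
                      (u′ , v′ , refl))
      where b′ = m+n≤o⇒m≤o (length u + length v) b

    decideNear : (k : ℕ) (τ : WordRel A) → (∀ {x y} → τ x y → Near k x y) → (∀ {x y} → Near k x y → τ x y) →
                 EachDecidable τ X
    decideNear k τ to-near from-near = decide τ (Near (k + k))
      (map′ (λ (x , y , x∈ , y∈ , d , x≢y) → x , y , x∈ , y∈ , from-near d , x≢y)
            (λ (x , y , x∈ , y∈ , d , x≢y) → x , y , x∈ , y∈ , to-near d , x≢y)
            (near-distinct? A↔Fin _≟ᴬ_ R k))
      (near-distinct? A↔Fin _≟ᴬ_ R (k + k))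
      (λ p q → inj₁ (near-trans (to-near p) (near-sym (to-near q))))
      (λ d → let z , p , q = near-midpoint d in z , from-near p , from-near (near-sym q))
      (regular-ext (λ (x , x∈ , d) → x , x∈ , map-closure from-near d)
                   (λ (x , x∈ , d) → x , x∈ , map-closure to-near d)
                   (regular-neighbourhood A↔Fin _≟ᴬ_ R k))
      (λ {w} uncompletable → k , w , ([] , [] , sym (++-identityʳ w)) , λ l r x k≤l k≤r x∈ →
        (λ d → near-unrelated uncompletable l r x k≤l k≤r (near-sym (to-near d)) x∈) ,
        (λ d → near-unrelated uncompletable l r x k≤l k≤r (to-near d) x∈))
      where
      map-closure : {τ σ : WordRel A} → (∀ {x y} → τ x y → σ x y) → ∀ {x y} → ReflClosure τ x y → ReflClosure σ x y
      map-closure f refl        = refl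
      map-closure f (related d) = related (f d)

  decide-𝒫 : ∀ k → EachDecidable (𝒫 k) X
  decide-𝒫 k = decideNear _ _ _ _ k (𝒫 k)
    (longest⇒near any commonPrefix? (λ {u} {v} {u′} {v′} → commonPrefix⁺ {u} {v} {u′} {v′}) commonPrefix⁻)
    (near⇒longest any commonPrefix? (λ {u} {v} {u′} {v′} → commonPrefix⁺ {u} {v} {u′} {v′}) commonPrefix⁻)
    where open Prefixes _≟ᴬ_

  decide-ℱ : ∀ k → EachDecidable (ℱ k) X
  decide-ℱ k = decideNear _ _ _ _ k (ℱ k)
    (longest⇒near any commonFactor? (λ {u} {v} {u′} {v′} → commonFactor⁺ {u} {v} {u′} {v′}) commonFactor⁻)
    (near⇒longest any commonFactor? (λ {u} {v} {u′} {v′} → commonFactor⁺ {u} {v} {u′} {v′}) commonFactor⁻)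
    where open Factors _≟ᴬ_

  module _ {θ : Word A → Word A} (sy : Symmetry θ) where

    open Symmetry sy

    decide-θ : EachDecidable (ReflClosure (graph θ)) X
    decide-θ = decide θ̂ θ̂ moved moved join (λ {x} {y} d → y , d , refl) neighbourhood unrelated
      where
      θ̂ : WordRel A
      θ̂ = ReflClosure (graph θ)

      moved : Dec (Distinct θ̂ X)
      moved = map′
        (λ (x , (x∈ , θx∈) , θx≢x) → x , θ x , x∈ , θx∈ , related refl , θx≢x ∘ sym)
        (λ { (x , _ , x∈ , _ , refl , x≢y) → contradiction refl x≢y
           ; (x , _ , x∈ , y∈ , related refl , x≢y) → x , (x∈ , y∈) , x≢y ∘ sym })
        (unfixed? any _≟ᴬ_ sy R)

      join : ∀ {x y z} → θ̂ x z → θ̂ y z → θ̂ x y ⊎ θ̂ y x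
      join refl        d           = inj₂ d
      join d           refl        = inj₁ d
      join {x} (related p) (related q) = inj₁ (subst (θ̂ x) (injective (trans p (sym q))) refl)

      -- This is X ∪ θ(X), where θ(X) is treated as the preimage of X under `θ⁻¹`.
      neighbourhood : Regular (image (ReflClosure θ̂) X)
      neighbourhood = regular-ext
        (λ { {y} (inj₁ y∈)    → y , y∈ , refl
           ; {y} (inj₂ θ⁻¹y∈) → θ⁻¹ y , θ⁻¹y∈ , related (related (inverseˡ y)) })
        (λ { (x , x∈ , refl) → inj₁ x∈
           ; (x , x∈ , related refl) → inj₁ x∈
           ; (x , x∈ , related (related refl)) → inj₂ (subst X (sym (inverseʳ x)) x∈) })
        (regular-∪ R (regular-preimage morphic⁻¹ R))

      unrelated : ∀ {w} → Uncompletable X w → ∃₂ λ k w₁ → Factor w w₁ ×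
        (∀ l r x → k ≤ length l → k ≤ length r → X x → ¬ θ̂ x (l ++ w₁ ++ r) × ¬ θ̂ (l ++ w₁ ++ r) x)
      -- Each of the three parts forces `w` into `x`: the part `w` if x is the new word, `θ w` if θ
      -- maps x to the new word, `θ⁻¹ w` if θ maps the new word to x. This holds for all `l` and
      -- `r`, hence the padding length 0.
      unrelated {w} uncompletable = 0 , w ++ θ⁻¹ w ++ θ w , ([] , _ , refl) , λ l r x _ _ x∈ →
        (λ { refl → absent (l , r , refl) w⊑w₁ x∈
           ; (related e) → uncompletable-factor uncompletable
               (subst₂ Factor (inverseʳ w) (trans (cong θ⁻¹ (sym e)) (inverseʳ x))
                 (morphic-factor {f = θ⁻¹} morphic⁻¹ (factor-trans θw⊑w₁ (l , r , refl)))) x∈ }) ,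
        (λ { refl → absent (l , r , refl) w⊑w₁ x∈
           ; (related e) → uncompletable-factor uncompletable
               (subst₂ Factor (inverseˡ w) e
                 (morphic-factor {f = θ} morphic (factor-trans θ⁻¹w⊑w₁ (l , r , refl)))) x∈ })
        where
        w₁ = w ++ θ⁻¹ w ++ θ w
        w⊑w₁ : Factor w w₁
        w⊑w₁ = [] , θ⁻¹ w ++ θ w , refl
        θ⁻¹w⊑w₁ : Factor (θ⁻¹ w) w₁
        θ⁻¹w⊑w₁ = w , θ w , refl
        θw⊑w₁ : Factor (θ w) w₁
        θw⊑w₁ = w ++ θ⁻¹ w , [] , trans (sym (++-assoc w (θ⁻¹ w) (θ w)))
          (cong ((w ++ θ⁻¹ w) ++_) (sym (++-identityʳ (θ w))))
        absent : ∀ {x} → Factor w₁ x → Factor w w₁ → ¬ X x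
        absent w₁⊑x w⊑ = uncompletable-factor uncompletable (factor-trans w⊑ w₁⊑x)

mainTheorem1 : (A : Set) (n : ℕ) → A ↔ Fin n → 2 ≤ n →
    (M : Automaton A) → IsCode (Recognized M) →
    (k : ℕ) → 1 ≤ k →
    (θ : Word A → Word A) → IsAutomorphism θ ⊎ IsAntiAutomorphism θ →
    EachDecidable (𝒫 k) (Recognized M) ×
    EachDecidable (ℱ k) (Recognized M) ×
    EachDecidable (ReflClosure (graph θ)) (Recognized M)
mainTheorem1 A n A↔Fin 2≤n M code k _ θ auto =
  decide-𝒫 k , decide-ℱ k , decide-θ (symmetry auto)
  where open Decide A↔Fin 2≤n (regular-Recognized M) code
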